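{- Let $G$ be a graph of order $n$ such that both $G$ and its complement $\overline{G}$ are connected. If $n\notin\{12,13,14,15,16,17,18,20,21,24\}$, then $$\gamma_P(G)+\gamma_P(\overline{G})\le \left\lceil\frac{n}{3}\right\rceil+1,$$ and this bound is attained for arbitrarily large $n\ge 6$ by graphs $G\in\mathcal{T}$.
   Context: All graphs are finite, simple, undirected, with nonempty vertex set; the order is the number of vertices. $N(v)$ is the set of neighbors of $v$, $N[v]=N(v)\cup\{v\}$, and $N[S]=\bigcup_{v\in S}N[v]$. For $S\subseteq V(G)$, define $PD(S)$ by: (1) start with $PD(S):=N[S]$; (2) while there exists $v\in PD(S)$ with $|N(v)\setminus PD(S)|=1$, set $PD(S):=PD(S)\cup N(v)$. $S$ is a power dominating set if $PD(S)=V(G)$ at the end of the process. The power domination number $\gamma_P(G)$ is the minimum cardinality of a power dominating set of $G$. $\mathcal{T}$ is the family of graphs constructed by starting with a connected graph $H$ and, for each $v\in V(H)$, adding two new vertices $v'$ and $v''$, each adjacent to $v$ and possibly to each other but not to any other vertices. -}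

module Defs where

open import Data.Bool.Base using (true; false)
import Data.Bool.Properties as Bool
open import Data.Fin.Base using (Fin)
import Data.Fin.Properties as Fin
open import Data.Fin.Subset
  using (Subset; _∈_; _∉_; _⊆_; _⊂_; _⊃_; ⊤; ⁅_⁆; _∪_; _─_; ∣_∣)
open import Data.Fin.Subset.Induction using (⊃-wellFounded; Acc; acc)
open import Data.Fin.Subset.Properties
open import Data.List.Base using (List; _∷_; [])
open import Data.Nat.Base
  using (ℕ; zero; suc; _+_; _*_; _≤_; _<_; z≤n; s≤s; s≤s⁻¹; NonZero)
open import Data.Nat.DivMod using (_/_; _%_; m≡m%n+[m/n]*n; m%n<n; m<n*o⇒m/o<n)
import Data.Nat.Properties as ℕ
open import Data.Product.Base using (∃; ∃-syntax; _×_; _,_; proj₁; proj₂)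
open import Data.Sum.Base using (inj₁; inj₂)
open import Data.Vec.Base using (tabulate; _∷_; here; there)
open import Data.Vec.Properties
  using (lookup∘tabulate; []=⇒lookup; lookup⇒[]=; ≡-dec)
open import Function.Base using (_∘_)
open import Function.Bundles using (_⇔_; mk⇔; _↔_; Inverse)
open import Level using (0ℓ)
open import Relation.Binary.Construct.Closure.ReflexiveTransitive using (Star; ε; _◅_)
open import Relation.Binary.Core using (Rel)
open import Relation.Binary.Definitions using (Decidable; Symmetric; Irreflexive)
open import Relation.Binary.PropositionalEquality
  using (_≡_; _≢_; refl; sym; trans; cong; subst)
open import Relation.Nullary
  using (¬_; does; yes; no; contradiction; ¬?; _×-dec_)
open import Relation.Nullary.Decidable using (dec-true)
import Relation.Unary as U

private
  variable
    n : ℕ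

-- The vertex set is Fin n, so n is the order of the graph.
record Graph (n : ℕ) : Set₁ where
  field
    nonempty : NonZero n
    Adj      : Rel (Fin n) 0ℓ
    adj?     : Decidable Adj
    symm     : Symmetric Adj
    irrefl   : Irreflexive _≡_ Adj

open Graph public

complement : Graph n → Graph n
complement G = record
  { nonempty = nonempty G
  ; Adj      = λ u v → u ≢ v × ¬ Adj G u v
  ; adj?     = λ u v → ¬? (u Fin.≟ v) ×-dec ¬? (adj? G u v)
  ; symm     = λ (u≢v , u≁v) → u≢v ∘ sym , u≁v ∘ symm G
  ; irrefl   = λ u≡v (u≢v , _) → u≢v u≡v
  }

Connected : Graph n → Set
Connected G = ∀ u v → Star (Adj G) u v

comprehension : {P : U.Pred (Fin n) 0ℓ} → U.Decidable P → Subset n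
comprehension P? = tabulate (does ∘ P?)

∈-comprehension⁺ : {P : U.Pred (Fin n) 0ℓ} (P? : U.Decidable P) →
                   ∀ {v} → P v → v ∈ comprehension P?
∈-comprehension⁺ P? {v} pv =
  lookup⇒[]= v _ (trans (lookup∘tabulate (does ∘ P?) v) (dec-true (P? v) pv))

∈-comprehension⁻ : {P : U.Pred (Fin n) 0ℓ} (P? : U.Decidable P) →
                   ∀ {v} → v ∈ comprehension P? → P v
∈-comprehension⁻ P? {v} v∈
  with P? v | trans (sym (lookup∘tabulate (does ∘ P?) v)) ([]=⇒lookup v∈)
... | yes pv | _ = pv
... | no  _  | ()

private

  least : {P : U.Pred ℕ 0ℓ} → U.Decidable P → ∀ i → P i →
          ∃[ k ] P k × (∀ j → P j → k ≤ j)
  least P? zero    p = zero , p , λ _ _ → z≤n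
  least P? (suc i) p with P? zero
  ... | yes p₀ = zero , p₀ , λ _ _ → z≤n
  ... | no ¬p₀ =
    let k , pk , k≤ = least (P? ∘ suc) i p
    in  suc k , pk , λ { zero    p₀ → contradiction p₀ ¬p₀
                       ; (suc j) pj → s≤s (k≤ j pj) }

  x∈p─q⇒x∉q : ∀ (p q : Subset n) {x} → x ∈ p ─ q → x ∉ q
  x∈p─q⇒x∉q (_ ∷ p) (true ∷ q)  ()         here
  x∈p─q⇒x∉q (_ ∷ p) (true ∷ q)  (there x∈) (there x∈q) = x∈p─q⇒x∉q p q x∈ x∈q
  x∈p─q⇒x∉q (_ ∷ p) (false ∷ q) (there x∈) (there x∈q) = x∈p─q⇒x∉q p q x∈ x∈q

  ─-antimonoʳ : ∀ (r : Subset n) {p q} → p ⊆ q → r ─ q ⊆ r ─ p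
  ─-antimonoʳ r {q = q} p⊆q x∈ =
    x∈p∧x∉q⇒x∈p─q (p─q⊆p r q x∈) (x∈p─q⇒x∉q r q x∈ ∘ p⊆q)

  ∣p∣<1⇒x∉p : ∀ {p : Subset n} {x} → ∣ p ∣ < 1 → x ∉ p
  ∣p∣<1⇒x∉p ∣p∣<1 x∈p = ℕ.n≮0 (ℕ.<-≤-trans (x∈p⇒∣p-x∣<∣p∣ x∈p) (s≤s⁻¹ ∣p∣<1))

module _ {n : ℕ} (G : Graph n) where

  N : Fin n → Subset n
  N v = comprehension (adj? G v)

  N[_] : Fin n → Subset n
  N[ v ] = N v ∪ ⁅ v ⁆

  N[_]ˢ : Subset n → Subset n
  N[ S ]ˢ = comprehension λ w → Fin.any? λ v → (v ∈? S) ×-dec (w ∈? N[ v ])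

  Forces : Subset n → Fin n → Set
  Forces X v = v ∈ X × ∣ N v ─ X ∣ ≡ 1

  Step : Rel (Subset n) 0ℓ
  Step X Y = ∃[ v ] Forces X v × Y ≡ X ∪ N v

  Stuck : Subset n → Set
  Stuck X = ¬ ∃ (Forces X)

  -- PD S X says that some complete run of the process on S ends in X.  Every
  -- run terminates (PD-exists) in a set independent of the choices of v
  -- (PD-unique), so X is the set PD(S).
  PD : Subset n → Subset n → Set
  PD S X = Star Step N[ S ]ˢ X × Stuck X

  private

    forces? : ∀ X → U.Decidable (Forces X)
    forces? X v = (v ∈? X) ×-dec (∣ N v ─ X ∣ ℕ.≟ 1)

    step-⊂ : ∀ {X v} → Forces X v → X ⊂ X ∪ N v
    step-⊂ {X} {v} (_ , one) with nonempty? (N v ─ X)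
    ... | yes (w , w∈) = p⊆p∪q (N v) , w
                       , q⊆p∪q X (N v) (p─q⊆p (N v) X w∈)
                       , x∈p─q⇒x∉q (N v) X w∈
    ... | no empty = contradiction
      (trans (sym one) (trans (cong ∣_∣ (Empty-unique empty)) (∣⊥∣≡0 n)))
      ℕ.1+n≢0

    complete : ∀ X → Acc _⊃_ X → ∃[ Y ] Star Step X Y × Stuck Y
    complete X (acc rec) with Fin.any? (forces? X)
    ... | no stuck    = X , ε , stuck
    ... | yes (v , f) =
      let Y , steps , stuck = complete (X ∪ N v) (rec (step-⊂ f))
      in  Y , (v , f , refl) ◅ steps , stuck

    run-⊆ : ∀ {X Y Z} → Star Step X Z → X ⊆ Y → Stuck Y → Z ⊆ Y
    run-⊆ ε X⊆Y _ = X⊆Y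
    run-⊆ {X} {Y} ((v , (v∈X , one) , refl) ◅ steps) X⊆Y stuck =
      run-⊆ steps X∪N⊆Y stuck
      where
      none : ∣ N v ─ Y ∣ < 1
      none = ℕ.≤∧≢⇒<
        (ℕ.≤-trans (p⊆q⇒∣p∣≤∣q∣ (─-antimonoʳ (N v) X⊆Y)) (ℕ.≤-reflexive one))
        (λ one′ → stuck (v , X⊆Y v∈X , one′))

      X∪N⊆Y : X ∪ N v ⊆ Y
      X∪N⊆Y {w} w∈ with x∈p∪q⁻ X (N v) w∈ | w ∈? Y
      ... | inj₁ w∈X | _       = X⊆Y w∈X
      ... | inj₂ _   | yes w∈Y = w∈Y
      ... | inj₂ w∈N | no  w∉Y =
        contradiction (x∈p∧x∉q⇒x∈p─q w∈N w∉Y) (∣p∣<1⇒x∉p none)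

    start-⊆ : ∀ {X Y} → Star Step X Y → X ⊆ Y
    start-⊆ ε                        = λ x∈ → x∈
    start-⊆ ((v , _ , refl) ◅ steps) = start-⊆ steps ∘ p⊆p∪q (N v)

  PD-exists : ∀ S → ∃ (PD S)
  PD-exists S = complete N[ S ]ˢ (⊃-wellFounded _)

  PD-unique : ∀ {S X Y} → PD S X → PD S Y → X ≡ Y
  PD-unique (runX , stuckX) (runY , stuckY) = ⊆-antisym
    (run-⊆ runX (start-⊆ runY) stuckY)
    (run-⊆ runY (start-⊆ runX) stuckX)

  PowerDominating : Subset n → Set
  PowerDominating S = PD S ⊤

  powerDominating? : U.Decidable PowerDominating
  powerDominating? S with PD-exists S
  ... | X , pd with ≡-dec Bool._≟_ X ⊤
  ...   | yes refl = yes pd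
  ...   | no  X≢⊤  = no (X≢⊤ ∘ PD-unique pd)

  ⊤-powerDominating : PowerDominating ⊤
  ⊤-powerDominating =
    subst (λ X → PD ⊤ X) (⊆-antisym ⊆⊤ (λ {v} _ → ⊤⊆X v)) (proj₂ (PD-exists ⊤))
    where
    ⊤⊆X : ∀ v → v ∈ proj₁ (PD-exists ⊤)
    ⊤⊆X v = start-⊆ (proj₁ (proj₂ (PD-exists ⊤)))
      (∈-comprehension⁺ (λ w → Fin.any? λ u → (u ∈? ⊤) ×-dec (w ∈? N[ u ]))
        (v , ∈⊤ , q⊆p∪q (N v) ⁅ v ⁆ (x∈⁅x⁆ v)))

  private

    minimum : ∃[ k ] (∃[ S ] PowerDominating S × ∣ S ∣ ≡ k) ×
                     (∀ j → (∃[ S ] PowerDominating S × ∣ S ∣ ≡ j) → k ≤ j)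
    minimum = least
      (λ k → anySubset? λ S → powerDominating? S ×-dec (∣ S ∣ ℕ.≟ k))
      _ (⊤ , ⊤-powerDominating , refl)

  γP : ℕ
  γP = proj₁ minimum

  γP-attained : ∃[ S ] PowerDominating S × ∣ S ∣ ≡ γP
  γP-attained = proj₁ (proj₂ minimum)

  γP-minimal : ∀ S → PowerDominating S → γP ≤ ∣ S ∣
  γP-minimal S pd = proj₂ (proj₂ minimum) _ (S , pd , refl)

data Part : Set where
  original first second : Part

-- (v , original) is v, (v , first) is v′ and (v , second) is v″; the vertices
-- v ∈ E are those for which the optional edge v′v″ is present.
data Attached {m : ℕ} (H : Graph m) (E : Subset m) : Rel (Fin m × Part) 0ℓ where
  old : ∀ {u v} → Adj H u v → Attached H E (u , original) (v , original)
  vv′ : ∀ {v} → Attached H E (v , original) (v , first)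
  v′v : ∀ {v} → Attached H E (v , first) (v , original)
  vv″ : ∀ {v} → Attached H E (v , original) (v , second)
  v″v : ∀ {v} → Attached H E (v , second) (v , original)
  v′v″ : ∀ {v} → v ∈ E → Attached H E (v , first) (v , second)
  v″v′ : ∀ {v} → v ∈ E → Attached H E (v , second) (v , first)

-- The family 𝒯, closed under isomorphism.
record 𝒯 (G : Graph n) : Set₁ where
  field
    {m}       : ℕ
    H         : Graph m
    connected : Connected H
    E         : Subset m
    vertices  : Fin n ↔ (Fin m × Part)
    edges     : ∀ u v → Adj G u v ⇔
                Attached H E (Inverse.to vertices u) (Inverse.to vertices v)

⌈_/3⌉ : ℕ → ℕ
⌈ n /3⌉ = (n + 2) / 3

⌈n/3⌉≤k⇔n≤k*3 : ∀ n k → ⌈ n /3⌉ ≤ k ⇔ n ≤ k * 3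
⌈n/3⌉≤k⇔n≤k*3 n k = mk⇔ to from
  where
  open ℕ.≤-Reasoning

  to : ⌈ n /3⌉ ≤ k → n ≤ k * 3
  to q≤k = ℕ.+-cancelʳ-≤ 2 n (k * 3) (begin
    n + 2                        ≡⟨ m≡m%n+[m/n]*n (n + 2) 3 ⟩
    (n + 2) % 3 + ⌈ n /3⌉ * 3    ≤⟨ ℕ.+-mono-≤ (s≤s⁻¹ (m%n<n (n + 2) 3)) (ℕ.*-monoˡ-≤ 3 q≤k) ⟩
    2 + k * 3                    ≡⟨ ℕ.+-comm 2 (k * 3) ⟩
    k * 3 + 2                    ∎)

  from : n ≤ k * 3 → ⌈ n /3⌉ ≤ k
  from n≤ = s≤s⁻¹ (m<n*o⇒m/o<n (begin-strict
    n + 2      ≤⟨ ℕ.+-monoˡ-≤ 2 n≤ ⟩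
    k * 3 + 2  <⟨ ℕ.+-monoʳ-< (k * 3) (ℕ.n<1+n 2) ⟩
    k * 3 + 3  ≡⟨ ℕ.+-comm (k * 3) 3 ⟩
    suc k * 3  ∎))

exceptionalOrders : List ℕ
exceptionalOrders = 12 ∷ 13 ∷ 14 ∷ 15 ∷ 16 ∷ 17 ∷ 18 ∷ 20 ∷ 21 ∷ 24 ∷ []

{-# OPTIONS --safe #-}

-- Write a = γP(G) and b = γP(Ḡ).  A minimum power dominating set can be chosen
-- so that each of its vertices has two private neighbours; hence 3a ≤ n.  If
-- 3a = n and a ≥ 2, it can moreover be chosen without isolated vertices, and
-- then private neighbours of different vertices are not adjacent (the exception
-- K₃,₃ has a disconnected complement), so that a single private neighbour power
-- dominates Ḡ.  This settles the case b ≤ 2.  If b ≥ 3, any two vertices have a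
-- common neighbour in G, so all degrees of G are at least a, and two vertices
-- chosen greedily, followed by one common neighbour for every two vertices that
-- are still undominated, are too few for b = 3 and n ≤ 3a + 3; the orders
-- n ≤ 11 are treated by hand, with a parity argument for 5-regular graphs.  If
-- a, b ≥ 4, then ab ≤ n by Jaeger and Payan, which leaves only exceptional
-- orders.  The bound is attained by complete graphs with two leaves attached to
-- each vertex, since each pair of leaves forces a vertex of a power dominating
-- set at their common neighbour or at one of them.
module Submission where

open import Defs
open import Data.Bool.Base using (true; false)
open import Data.Empty using () renaming (⊥ to Empty)
open import Data.Fin.Base as Fin using (Fin; punchIn; punchOut)
import Data.Fin.Properties as Fin
open import Data.Fin.Subset using (Subset; _⊆_; _⊂_; _⊃_; ⊥; ⁅_⁆; _∪_; _─_; ∣_∣)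
  renaming (_∈_ to _∈ˢ_; _∉_ to _∉ˢ_)
open import Data.Fin.Subset.Induction using (⊃-wellFounded; Acc; acc)
open import Data.Fin.Subset.Properties renaming (_∈?_ to _∈ˢ?_)
open import Data.List.Base using (List; []; _∷_; foldr; length; filter; map; allFin; tabulate)
open import Data.List.Membership.Propositional using (_∈_; _∉_)
open import Data.List.Membership.Propositional.Properties
  using (∈-tabulate⁺; ∈-allFin; ∈-filter⁺; ∈-filter⁻)
open import Data.List.Properties using (length-tabulate; map-cong)
open import Data.List.Relation.Unary.All as All using (_∷_)
open import Data.List.Relation.Unary.AllPairs using (_∷_)
open import Data.List.Relation.Unary.Any using (here; there)
open import Data.List.Relation.Unary.Unique.Propositional using (Unique)
import Data.List.Relation.Unary.Unique.Propositional.Properties as Unique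
open import Data.Nat.Base using (ℕ; zero; suc; _+_; _*_; _≤_; _<_; _>_; z≤n; s≤s; NonZero)
open import Data.Nat.Divisibility using (_∣_; _∣?_; m∣m*n)
open import Data.Nat.ListAction using (sum)
import Data.Nat.Properties as ℕ
open import Data.Nat.Tactic.RingSolver using (solve-∀)
open import Data.Product.Base using (_×_; _,_; proj₁; proj₂; Σ-syntax; ∃-syntax; uncurry)
open import Data.Product.Function.NonDependent.Propositional using (_×-↔_)
open import Data.Sum.Base as Sum using (_⊎_; inj₁; inj₂)
open import Data.Vec.Base using ([]; _∷_; here; there)
open import Data.Vec.Functional using (updateAt)
open import Data.Vec.Functional.Properties using (updateAt-updates; updateAt-minimal)
open import Function.Base using (_∘_; case_of_)
open import Function.Bundles using (Equivalence; Inverse; _↔_; mk↔ₛ′; mk⇔)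
open import Function.Construct.Composition using (_↔-∘_)
open import Function.Construct.Identity using (↔-id)
open import Level using (0ℓ)
open import Relation.Binary.Construct.Closure.ReflexiveTransitive as Star using (Star; ε; _◅_; _◅◅_)
open import Relation.Binary.Core using (Rel)
open import Relation.Binary.Definitions using (Decidable)
open import Relation.Binary.PropositionalEquality
open import Relation.Nullary using (¬_; Dec; yes; no; contradiction; ¬?; _×-dec_; _⊎-dec_; _→-dec_)
open import Relation.Nullary.Decidable using (decidable-stable; True; toWitness; from-no; from-yes)
open import Relation.Unary as U using (Pred)

open import Algebra.Properties.CommutativeSemigroup ℕ.+-commutativeSemigroup using (interchange)
open import Data.List.Membership.DecPropositional ℕ._≟_ using (_∈?_)

-- Let b ≤ a. If the bound fails, then n ≤ 3(a + b - 2). Against 3a ≤ n this leaves nothing for b =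
-- 1, only n = 3a for b = 2, the range from 3a to 3a + 3 for b = 3, and, with ab ≤ n, the condition
-- (a - 3)(b - 3) ≤ 3 for b ≥ 4. The exceptional orders are those at which counting is inconclusive.
-- For b = 3 the greedy choice gives a contradiction only if 2(a - 2)(n - 1) > (n - 1 - a)(n - 2 -
-- a). Apart from n = 9, 10, 11, this fails for some a exactly at the listed orders; the last
-- failure is n = 24, a = 7, with 230 against 240. The case b ≥ 4 leaves only 16 to 18, 20, 21 and
-- 24, which are among them. The obstacle in choosing a good set is that repairing one centre may
-- spoil another. Progress is therefore not measured by private neighbours but by the set of centres
-- adjacent to some centre: only centres outside that set are moved, so it never shrinks.

private
  variable
    m n k : ℕ

-- Observation as an inductive closure

module _ {n : ℕ} (G : Graph n) where

  Near : Rel (Fin n) 0ℓ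
  Near v w = v ≡ w ⊎ Adj G v w

  near? : Decidable Near
  near? v w = (v Fin.≟ w) ⊎-dec adj? G v w

  -- The least set closed under the rules of the process. It depends on no order of steps and
  -- involves no cardinalities: "exactly one unobserved neighbour" becomes "all other neighbours are
  -- observed".
  data Observed (S : Pred (Fin n) 0ℓ) : Pred (Fin n) 0ℓ where
    near  : ∀ {v w} → S v → Near v w → Observed S w
    force : ∀ {v w} → Observed S v → Adj G v w →
            (∀ {u} → Adj G v u → u ≢ w → Observed S u) → Observed S w

  Observing : Pred (Fin n) 0ℓ → Set
  Observing S = ∀ w → Observed S w

  Dominating : Pred (Fin n) 0ℓ → Set
  Dominating S = ∀ w → ∃[ v ] S v × Near v w

  -- The case `u ≡ v` is included on purpose: it provides every vertex with a neighbour, as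
  -- `last-observed` requires.
  HasCommonNeighbours : Set
  HasCommonNeighbours = ∀ u v → ∃[ w ] Adj G w u × Adj G w v

module _ {n : ℕ} {G : Graph n} where

  dominating⇒observing : ∀ {S} → Dominating G S → Observing G S
  dominating⇒observing dom w = let v , v∈ , vw = dom w in near v∈ vw

  source : ∀ {S v} → S v → Observed G S v
  source v∈ = near v∈ (inj₁ refl)

  -- The forcing steps of a derivation can be replayed, so only its sources have to be observed
  -- anew. This is how one family of centres is exchanged for another.
  observed-⊆ : ∀ {S T} → (∀ {v} → S v → ∀ {w} → Near G v w → Observed G T w) →
               ∀ {w} → Observed G S w → Observed G T w
  observed-⊆ f (near v∈ vw)       = f v∈ vw
  observed-⊆ f (force v∈ vw rest) =
    force (observed-⊆ f v∈) vw λ vu u≢w → observed-⊆ f (rest vu u≢w)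

  observed-mono : ∀ {S T} → (∀ {v} → S v → T v) →
                  ∀ {w} → Observed G S w → Observed G T w
  observed-mono S⊆T = observed-⊆ λ v∈ vw → near (S⊆T v∈) vw

  connected-closure : Connected G → {P : Pred (Fin n) 0ℓ} →
                      (∀ {u v} → P u → Adj G u v → P v) → ∀ {u v} → P u → P v
  connected-closure conn {P} closed {u} {v} = go (conn u v)
    where
    go : ∀ {u v} → Star (Adj G) u v → P u → P v
    go ε         pu = pu
    go (e ◅ es) pu = go es (closed pu e)

-- Subsets, lists and indexed families

∣p∣≡1⇒x≡y : ∀ {p : Subset n} {x y} → ∣ p ∣ ≡ 1 → x ∈ˢ p → y ∈ˢ p → x ≡ y
∣p∣≡1⇒x≡y {p = p} {x} {y} one x∈ y∈ with y Fin.≟ x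
... | yes y≡x = sym y≡x
... | no  y≢x = contradiction
  (ℕ.≤-trans (x∈p⇒∣p-x∣<∣p∣ (x∈p∧x≢y⇒x∈p-y y∈ y≢x))
             (ℕ.≤-pred (ℕ.≤-trans (x∈p⇒∣p-x∣<∣p∣ x∈) (ℕ.≤-reflexive one))))
  ℕ.n≮0

x∈p─q⇒x∉q : ∀ (p q : Subset n) {x} → x ∈ˢ p ─ q → x ∉ˢ q
x∈p─q⇒x∉q (_ ∷ p) (true ∷ q)  (there x∈) (there x∈q) = x∈p─q⇒x∉q p q x∈ x∈q
x∈p─q⇒x∉q (_ ∷ p) (false ∷ q) (there x∈) (there x∈q) = x∈p─q⇒x∉q p q x∈ x∈q

fromList : List (Fin n) → Subset n
fromList = foldr (λ x p → ⁅ x ⁆ ∪ p) ⊥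

∣fromList∣≤length : (xs : List (Fin n)) → ∣ fromList xs ∣ ≤ length xs
∣fromList∣≤length {n} []       = ℕ.≤-reflexive (∣⊥∣≡0 n)
∣fromList∣≤length     (x ∷ xs) = ℕ.≤-trans (∣p∪q∣≤ ⁅ x ⁆ (fromList xs))
  (ℕ.+-mono-≤ (ℕ.≤-reflexive (∣⁅x⁆∣≡1 x)) (∣fromList∣≤length xs))
  where
  ∣p∪q∣≤ : ∀ {n} (p q : Subset n) → ∣ p ∪ q ∣ ≤ ∣ p ∣ + ∣ q ∣
  ∣p∪q∣≤ []          []          = z≤n
  ∣p∪q∣≤ (false ∷ p) (false ∷ q) = ∣p∪q∣≤ p q
  ∣p∪q∣≤ (true  ∷ p) (false ∷ q) = s≤s (∣p∪q∣≤ p q)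
  ∣p∪q∣≤ (false ∷ p) (true  ∷ q) = ℕ.≤-trans (s≤s (∣p∪q∣≤ p q)) (ℕ.≤-reflexive (sym (ℕ.+-suc _ _)))
  ∣p∪q∣≤ (true  ∷ p) (true  ∷ q) = s≤s (ℕ.≤-trans (∣p∪q∣≤ p q) (ℕ.+-monoʳ-≤ ∣ p ∣ (ℕ.n≤1+n _)))

∈-fromList : {xs : List (Fin n)} {x : Fin n} → x ∈ xs → x ∈ˢ fromList xs
∈-fromList {x = x} (here refl) = p⊆p∪q _ (x∈⁅x⁆ x)
∈-fromList         (there x∈)  = q⊆p∪q _ _ (∈-fromList x∈)

Range : {A : Set} → (Fin k → A) → Pred A 0ℓ
Range c x = ∃[ i ] c i ≡ x

enumerate : (p : Subset n) → Σ[ c ∈ (Fin ∣ p ∣ → Fin n) ] (∀ {x} → x ∈ˢ p → Range c x)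
enumerate []          = (λ ()) , λ ()
enumerate (false ∷ p) = let c , onto = enumerate p in
  Fin.suc ∘ c , λ { (there x∈) → let i , eq = onto x∈ in i , cong Fin.suc eq }
enumerate (true ∷ p)  = let c , onto = enumerate p in
  (λ { Fin.zero → Fin.zero ; (Fin.suc i) → Fin.suc (c i) }) ,
  λ { here → Fin.zero , refl
    ; (there x∈) → let i , eq = onto x∈ in Fin.suc i , cong Fin.suc eq }

-- Power domination as observation

module _ {n : ℕ} (G : Graph n) where

  private
    run-⊆ : ∀ {X Y} → Star (Step G) X Y → X ⊆ Y
    run-⊆ ε                        = λ x∈ → x∈
    run-⊆ ((v , _ , refl) ◅ steps) = run-⊆ steps ∘ p⊆p∪q (N G v)

    initial? : (S : Subset n) → U.Decidable (λ w → ∃[ v ] v ∈ˢ S × w ∈ˢ N[_] G v)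
    initial? S w = Fin.any? λ v → (v ∈ˢ? S) ×-dec (w ∈ˢ? N[_] G v)

    near⇒∈N[] : ∀ {v w} → Near G v w → w ∈ˢ N[_] G v
    near⇒∈N[] {v} (inj₁ refl) = q⊆p∪q (N G v) ⁅ v ⁆ (x∈⁅x⁆ v)
    near⇒∈N[] {v} (inj₂ vw)   = p⊆p∪q ⁅ v ⁆ (∈-comprehension⁺ (adj? G v) vw)

    ∈N[]⇒near : ∀ {v w} → w ∈ˢ N[_] G v → Near G v w
    ∈N[]⇒near {v} {w} w∈ with x∈p∪q⁻ (N G v) ⁅ v ⁆ w∈
    ... | inj₁ w∈N = inj₂ (∈-comprehension⁻ (adj? G v) w∈N)
    ... | inj₂ w∈v = inj₁ (sym (x∈⁅y⁆⇒x≡y v w∈v))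

    -- If a forced `w` were missing from the stuck set `X`, it would be the only neighbour of `v`
    -- missing from `X`, and `v` could still force.
    observed⊆ : ∀ {S X} → Star (Step G) (N[_]ˢ G S) X → Stuck G X →
                ∀ {w} → Observed G (_∈ˢ S) w → w ∈ˢ X
    observed⊆ {S} run stuck (near v∈ vw) =
      run-⊆ run (∈-comprehension⁺ (initial? S) (_ , v∈ , near⇒∈N[] vw))
    observed⊆ {S} {X} run stuck (force {v} {w} v∈ vw rest) with w ∈ˢ? X
    ... | yes w∈ = w∈
    ... | no  w∉ = contradiction (v , observed⊆ run stuck v∈ , one) stuck
      where
      only-w : N G v ─ X ⊆ ⁅ w ⁆
      only-w {u} u∈ with u Fin.≟ w
      ... | yes refl = x∈⁅x⁆ u
      ... | no  u≢w  = contradiction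
        (observed⊆ run stuck
          (rest (∈-comprehension⁻ (adj? G v) (p─q⊆p (N G v) X u∈)) u≢w))
        (x∈p─q⇒x∉q (N G v) X u∈)

      w-only : ⁅ w ⁆ ⊆ N G v ─ X
      w-only u∈ rewrite x∈⁅y⁆⇒x≡y w u∈ =
        x∈p∧x∉q⇒x∈p─q (∈-comprehension⁺ (adj? G v) vw) w∉

      one : ∣ N G v ─ X ∣ ≡ 1
      one = trans (cong ∣_∣ (⊆-antisym only-w w-only)) (∣⁅x⁆∣≡1 w)

    run⊆observed : ∀ {S X Y} → Star (Step G) X Y →
                   (∀ {w} → w ∈ˢ X → Observed G S w) →
                   ∀ {w} → w ∈ˢ Y → Observed G S w
    run⊆observed ε                                     obs = obs
    run⊆observed {S} {X} ((v , (v∈ , one) , refl) ◅ steps) obs =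
      run⊆observed steps obs′
      where
      obs′ : ∀ {w} → w ∈ˢ X ∪ N G v → Observed G S w
      obs′ {w} w∈ with x∈p∪q⁻ X (N G v) w∈ | w ∈ˢ? X
      ... | inj₁ w∈X | _       = obs w∈X
      ... | inj₂ _   | yes w∈X = obs w∈X
      ... | inj₂ w∈N | no  w∉X = force (obs v∈) (∈-comprehension⁻ (adj? G v) w∈N) others
        where
        others : ∀ {u} → Adj G v u → u ≢ w → Observed G S u
        others {u} vu u≢w with u ∈ˢ? X
        ... | yes u∈X = obs u∈X
        ... | no  u∉X = contradiction
          (∣p∣≡1⇒x≡y one
            (x∈p∧x∉q⇒x∈p─q (∈-comprehension⁺ (adj? G v) vu) u∉X)
            (x∈p∧x∉q⇒x∈p─q w∈N w∉X))
          u≢w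

  observing⇒powerDominating : ∀ S → Observing G (_∈ˢ S) → PowerDominating G S
  observing⇒powerDominating S obs =
    let X , run , stuck = PD-exists G S
    in  subst (PD G S) (⊆-antisym ⊆⊤ (λ _ → observed⊆ run stuck (obs _))) (run , stuck)

  powerDominating⇒observing : ∀ {S} → PowerDominating G S → Observing G (_∈ˢ S)
  powerDominating⇒observing {S} (run , _) w = run⊆observed run initial ∈⊤
    where
    initial : ∀ {w} → w ∈ˢ N[_]ˢ G S → Observed G (_∈ˢ S) w
    initial w∈ = let v , v∈ , w∈N = ∈-comprehension⁻ (initial? S) w∈
                 in  near v∈ (∈N[]⇒near w∈N)

  γP≤length : (xs : List (Fin n)) → Observing G (_∈ xs) → γP G ≤ length xs
  γP≤length xs obs = ℕ.≤-trans
    (γP-minimal G (fromList xs)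
      (observing⇒powerDominating _ (λ w → observed-mono ∈-fromList (obs w))))
    (∣fromList∣≤length xs)

  -- The two characteristic properties of the minimum, for an arbitrary `k` that can be matched as a
  -- successor. The centres form a family, possibly with repetitions, so that one centre can be
  -- moved by an update at its index.
  IsγP : ℕ → Set
  IsγP k = (Σ[ c ∈ (Fin k → Fin n) ] Observing G (Range c)) ×
           (∀ xs → Observing G (_∈ xs) → k ≤ length xs)

  γP-isγP : IsγP (γP G)
  γP-isγP = family (γP-attained G) , γP≤length
    where
    family : ∀ {k} → (∃[ S ] PowerDominating G S × ∣ S ∣ ≡ k) →
             Σ[ c ∈ (Fin k → Fin n) ] Observing G (Range c)
    family (S , pd , refl) =
      let c , onto = enumerate S
      in  c , λ w → observed-mono onto (powerDominating⇒observing pd w)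

module _ {n : ℕ} {G : Graph n} where

  isγP⇒≤ : IsγP G k → (c : Fin m → Fin n) → Observing G (Range c) → k ≤ m
  isγP⇒≤ (_ , minimal) c obs = ℕ.≤-trans
    (minimal (tabulate c)
      (λ w → observed-mono (λ { (i , refl) → ∈-tabulate⁺ i }) (obs w)))
    (ℕ.≤-reflexive (length-tabulate c))

  isγP⇒positive : IsγP G k → ∃[ m ] k ≡ suc m
  isγP⇒positive {suc k} _               = k , refl
  isγP⇒positive {zero}  ((c , obs) , _) = contradiction (obs (vertex (nonempty G))) unobserved
    where
    unobserved : ∀ {w} → ¬ Observed G (Range c) w
    unobserved (near (() , _) _)
    unobserved (force v∈ _ _) = unobserved v∈

    vertex : ∀ {n} → .(NonZero n) → Fin n
    vertex {suc n} _ = Fin.zero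

-- Centres of degree at least two

module _ {n : ℕ} (G : Graph n) where

  -- A centre with two neighbours of which at most one is private shares a neighbour with another
  -- centre or is adjacent to one; `improve` depends on this.
  Branching : Pred (Fin n) 0ℓ
  Branching v = ∃[ x ] ∃[ y ] x ≢ y × Adj G v x × Adj G v y

  branching? : U.Decidable Branching
  branching? v = Fin.any? λ x → Fin.any? λ y →
    ¬? (x Fin.≟ y) ×-dec adj? G v x ×-dec adj? G v y

thirdVertex : 3 ≤ n → (u v : Fin n) → ∃[ w ] w ≢ u × w ≢ v
thirdVertex (s≤s (s≤s (s≤s z≤n))) u v with u Fin.≟ v
... | yes refl = punchIn u Fin.zero , Fin.punchInᵢ≢i u _ , Fin.punchInᵢ≢i u _
... | no  u≢v  = punchIn u w′ , Fin.punchInᵢ≢i u w′ , λ eq →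
  Fin.punchInᵢ≢i v′ Fin.zero
    (Fin.punchIn-injective u _ _ (trans eq (sym (Fin.punchIn-punchOut u≢v))))
  where
  v′ = punchOut u≢v
  w′ = punchIn v′ Fin.zero

module _ {n : ℕ} {G : Graph n} (conn : Connected G) (3≤n : 3 ≤ n) where

  neighbour : ∀ v → ∃[ w ] Adj G v w
  neighbour v with Fin.any? (adj? G v)
  ... | yes found = found
  ... | no  none  = let w , w≢v , _ = thirdVertex 3≤n v v in contradiction
    (connected-closure {G = G} conn {_≡ v} (λ { refl a → contradiction (_ , a) none }) refl) w≢v

  -- A leaf observes no more than its neighbour does, and the neighbour of a
  -- leaf is not a leaf when there is a third vertex.
  support : ∀ v → ∃[ s ] Branching G s ×
            (s ≡ v ⊎ Adj G s v × (∀ {x} → Adj G v x → x ≡ s))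
  support v with branching? G v
  ... | yes b  = v , b , inj₁ refl
  ... | no  ¬b with neighbour v
  ...   | s , vs = s , branches , inj₂ (symm G vs , only)
    where
    only : ∀ {x} → Adj G v x → x ≡ s
    only {x} vx with x Fin.≟ s
    ... | yes eq  = eq
    ... | no  x≢s = contradiction (x , s , x≢s , vx , vs) ¬b

    branches : Branching G s
    branches with Fin.any? (λ x → ¬? (x Fin.≟ v) ×-dec adj? G s x)
    ... | yes (x , x≢v , sx) = x , v , x≢v , sx , symm G vs
    ... | no  none with thirdVertex 3≤n v s
    ...   | w , w≢v , w≢s with connected-closure {G = G} conn {λ x → x ≡ v ⊎ x ≡ s} closed {v} {w} (inj₁ refl)
      where
      closed : ∀ {x y} → x ≡ v ⊎ x ≡ s → Adj G x y → y ≡ v ⊎ y ≡ s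
      closed (inj₁ refl) vy = inj₂ (only vy)
      closed {y = y} (inj₂ refl) sy with y Fin.≟ v
      ... | yes eq  = inj₁ eq
      ... | no  y≢v = contradiction (y , y≢v , sy) none
    ...     | inj₁ eq = contradiction eq w≢v
    ...     | inj₂ eq = contradiction eq w≢s

  branching-family : (c : Fin k → Fin n) → Observing G (Range c) →
                     ∃[ c′ ] Observing G (Range {k} c′) × (∀ i → Branching G (c′ i))
  branching-family c obs =
    proj₁ ∘ support ∘ c , (λ w → observed-⊆ f (obs w)) , proj₁ ∘ proj₂ ∘ support ∘ c
    where
    f : ∀ {v} → Range c v → ∀ {w} → Near G v w → Observed G (Range (proj₁ ∘ support ∘ c)) w
    f (i , refl) nr with support (c i) in eq
    ... | s , _ , inj₁ refl = near (i , cong proj₁ eq) nr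
    f (i , refl) (inj₁ refl) | s , _ , inj₂ (sv , _) = near (i , cong proj₁ eq) (inj₂ sv)
    f (i , refl) (inj₂ vw)   | s , _ , inj₂ (_ , only) = source (i , trans (cong proj₁ eq) (sym (only vw)))

-- Private neighbours and the bound 3a ≤ n

module PrivateNeighbours
  {n : ℕ} (G : Graph n) {m : ℕ}
  (irreducible : (c : Fin m → Fin n) → ¬ Observing G (Range c))
  where

  private
    variable
      c c′ : Fin (suc m) → Fin n
      i j l : Fin (suc m)
      x y w : Fin n

  Others : (Fin (suc m) → Fin n) → Fin (suc m) → Pred (Fin n) 0ℓ
  Others c i v = ∃[ j ] j ≢ i × c j ≡ v

  others-insufficient : ∀ i → ¬ Observing G (Others c i)
  others-insufficient {c} i obs = irreducible (c ∘ punchIn i) λ w →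
    observed-mono (λ { (j , j≢i , refl) →
      punchOut (j≢i ∘ sym) , cong c (Fin.punchIn-punchOut (j≢i ∘ sym)) }) (obs w)

  Private : (Fin (suc m) → Fin n) → Fin (suc m) → Pred (Fin n) 0ℓ
  Private c i w = Adj G (c i) w × (∀ j → j ≢ i → ¬ Near G (c j) w)

  private? : ∀ c i → U.Decidable (Private c i)
  private? c i w = adj? G (c i) w ×-dec
    Fin.all? λ j → ¬? (j Fin.≟ i) →-dec (¬? (near? G (c j) w))

  private-unique : Private c i w → Private c j w → i ≡ j
  private-unique {i = i} {j = j} (a , _) (_ , b) with i Fin.≟ j
  ... | yes eq = eq
  ... | no  i≢j = contradiction (inj₂ a) (b i i≢j)

  near-private : Private c i w → Near G (c j) w → j ≡ i
  near-private {i = i} {j = j} (_ , only) nr with j Fin.≟ i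
  ... | yes eq = eq
  ... | no  j≢i = contradiction nr (only j j≢i)

  private≢centre : Private c i w → c j ≢ w
  private≢centre pw refl with near-private pw (inj₁ refl)
  ... | refl = irrefl G refl (proj₁ pw)

  TwoPrivate : (Fin (suc m) → Fin n) → Pred (Fin (suc m)) 0ℓ
  TwoPrivate c i = ∃[ x ] ∃[ y ] x ≢ y × Private c i x × Private c i y

  twoPrivate? : ∀ c → U.Decidable (TwoPrivate c)
  twoPrivate? c i = Fin.any? λ x → Fin.any? λ y →
    ¬? (x Fin.≟ y) ×-dec private? c i x ×-dec private? c i y

  AtMostOnePrivate : (Fin (suc m) → Fin n) → Pred (Fin (suc m)) 0ℓ
  AtMostOnePrivate c i = ∀ {x y} → Private c i x → Private c i y → x ≡ y

  ¬two⇒atMostOne : ¬ TwoPrivate c i → AtMostOnePrivate c i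
  ¬two⇒atMostOne ¬two {x} {y} px py with x Fin.≟ y
  ... | yes eq  = eq
  ... | no  x≢y = contradiction (x , y , x≢y , px , py) ¬two

  -- A centre with at most one private neighbour is needed only to be observed:
  -- it then forces that neighbour.
  replace : ∀ {T} → Observing G (Range c) → AtMostOnePrivate c i →
            (∀ {v} → Others c i v → T v) → Observed G T (c i) → Observing G T
  replace {c} {i} {T} obs one others ci w = observed-⊆ f (obs w)
    where
    f : ∀ {v} → Range c v → ∀ {w} → Near G v w → Observed G T w
    f (j , refl) nr with j Fin.≟ i
    f (j , refl) nr          | no  j≢i  = near (others (j , j≢i , refl)) nr
    f (j , refl) (inj₁ refl) | yes refl = ci
    f (j , refl) {w} (inj₂ a) | yes refl with private? c i w
    ... | yes pw = force ci a rest
      where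
      rest : ∀ {u} → Adj G (c i) u → u ≢ w → Observed G T u
      rest {u} au u≢w with Fin.any? (λ l → ¬? (l Fin.≟ i) ×-dec near? G (c l) u)
      ... | yes (l , l≢i , lu) = near (others (l , l≢i , refl)) lu
      ... | no  none = contradiction
        (one (au , λ l l≢i lu → none (l , l≢i , lu)) pw) u≢w
    ... | no ¬pw with Fin.any? (λ l → ¬? (l Fin.≟ i) ×-dec near? G (c l) w)
    ...   | yes (l , l≢i , lw) = near (others (l , l≢i , refl)) lw
    ...   | no  none = contradiction (a , λ l l≢i lw → none (l , l≢i , lw)) ¬pw

  -- Otherwise the remaining centres would observe `c i`, hence by `replace` everything, and one
  -- centre could be saved.
  undominated : Observing G (Range c) → AtMostOnePrivate c i →
                j ≢ i → ¬ Near G (c j) (c i)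
  undominated obs one j≢i nr =
    others-insufficient _ (replace obs one (λ o → o) (near (_ , j≢i , refl) nr))

  Linked : (Fin (suc m) → Fin n) → Pred (Fin (suc m)) 0ℓ
  Linked c i = ∃[ j ] Adj G (c i) (c j)

  linked? : ∀ c → U.Decidable (Linked c)
  linked? c i = Fin.any? λ j → adj? G (c i) (c j)

  -- The measure of progress, ordered by inclusion. An unlinked centre is an end of no link, so
  -- moving it destroys none.
  links : (Fin (suc m) → Fin n) → Subset (suc m)
  links c = comprehension (linked? c)

  update : Fin (suc m) → Fin n → (Fin (suc m) → Fin n) → (Fin (suc m) → Fin n)
  update i x c = updateAt c i λ _ → x

  update-at : ∀ i x c → update i x c i ≡ x
  update-at i x c = updateAt-updates i c

  update-away : ∀ i x c → j ≢ i → update i x c j ≡ c j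
  update-away {j = j} i x c = updateAt-minimal j i c

  update-source : ∀ i x c → Range (update i x c) x
  update-source i x c = i , update-at i x c

  update-others : ∀ i x c {v} → Others c i v → Range (update i x c) v
  update-others i x c (j , j≢i , refl) = j , update-away i x c j≢i

  update-cases : ∀ i x c {P : Pred (Fin n) 0ℓ} → P x → (∀ j → j ≢ i → P (c j)) →
                 ∀ j → P (update i x c j)
  update-cases i x c {P} px pc j with j Fin.≟ i
  ... | yes refl = subst P (sym (update-at i x c)) px
  ... | no  j≢i  = subst P (sym (update-away i x c j≢i)) (pc j j≢i)

  links-update : ∀ i x c → ¬ Linked c i → links c ⊆ links (update i x c)
  links-update i x c ¬li {l} l∈ with ∈-comprehension⁻ (linked? c) l∈
  ... | j , a = ∈-comprehension⁺ (linked? (update i x c))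
    (j , subst₂ (Adj G) (sym (update-away i x c l≢i)) (sym (update-away i x c j≢i)) a)
    where
    l≢i : l ≢ i
    l≢i refl = ¬li (j , a)
    j≢i : j ≢ i
    j≢i refl = ¬li (l , symm G a)

  Good : (Fin (suc m) → Fin n) → Set
  Good c = Observing G (Range c) × (∀ i → Branching G (c i))

  -- By `undominated` the centre `c i` is unlinked, so one of its neighbours `x` is shared with some
  -- `c j`. Moved to `x`, it still observes its old place, which is enough for `replace`, and it is
  -- now linked to `c j`. The new centre is branching because of `c i` and `c j`.
  improve : Good c → ¬ TwoPrivate c i → ∃[ c′ ] Good c′ × links c ⊂ links c′
  improve {c} {i} (obs , branching) ¬two =
    moved shared
    where
    one : AtMostOnePrivate c i
    one = ¬two⇒atMostOne ¬two

    far : j ≢ i → ¬ Near G (c j) (c i)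
    far = undominated obs one

    unlinked : ¬ Linked c i
    unlinked (j , a) = far (λ { refl → irrefl G refl a }) (inj₂ (symm G a))

    sharedAt : ∀ {x} → Adj G (c i) x → ¬ Private c i x → ∃[ j ] j ≢ i × Adj G (c j) x
    sharedAt {x} a ¬px with Fin.any? (λ l → ¬? (l Fin.≟ i) ×-dec near? G (c l) x)
    ... | no none = contradiction (a , λ l l≢i lx → none (l , l≢i , lx)) ¬px
    ... | yes (l , l≢i , inj₁ refl) = contradiction (l , a) unlinked
    ... | yes (l , l≢i , inj₂ lx)   = l , l≢i , lx

    shared : ∃[ x ] ∃[ j ] j ≢ i × Adj G (c i) x × Adj G (c j) x
    shared with branching i
    ... | x , y , x≢y , ax , ay with private? c i x
    ...   | no ¬px = let j , j≢i , jx = sharedAt ax ¬px in x , j , j≢i , ax , jx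
    ...   | yes px = let j , j≢i , jy = sharedAt ay (λ py → x≢y (one px py))
                     in  y , j , j≢i , ay , jy

    moved : (∃[ x ] ∃[ j ] j ≢ i × Adj G (c i) x × Adj G (c j) x) →
            ∃[ c′ ] Good c′ × links c ⊂ links c′
    moved (x , j , j≢i , ix , jx) =
      update i x c
      , ( replace obs one (update-others i x c)
            (near (update-source i x c) (inj₂ (symm G ix)))
        , update-cases i x c {Branching G}
            (c i , c j , (λ eq → far j≢i (inj₁ (sym eq))) , symm G ix , symm G jx)
            (λ l _ → branching l))
      , links-update i x c unlinked
      , i
      , ∈-comprehension⁺ (linked? (update i x c))
          (j , subst₂ (Adj G) (sym (update-at i x c)) (sym (update-away i x c j≢i)) (symm G jx))
      , unlinked ∘ ∈-comprehension⁻ (linked? c)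

  twoPrivate-exists : Good c → ∃[ c′ ] Good c′ × (∀ i → TwoPrivate c′ i)
  twoPrivate-exists good = go good (⊃-wellFounded _)
    where
    go : Good c → Acc _⊃_ (links c) → ∃[ c′ ] Good c′ × (∀ i → TwoPrivate c′ i)
    go {c} good (acc rec) with Fin.all? (twoPrivate? c)
    ... | yes all = c , good , all
    ... | no ¬all =
      let i , ¬two = Fin.¬∀⟶∃¬ _ _ (twoPrivate? c) ¬all
          c′ , good′ , bigger = improve good ¬two
      in  go good′ (rec bigger)

  module Groups (two : ∀ i → TwoPrivate c i) where

    member : Fin (suc m) → Fin 3 → Fin n
    member i Fin.zero                       = c i
    member i (Fin.suc Fin.zero)             = proj₁ (two i)
    member i (Fin.suc (Fin.suc Fin.zero))   = proj₁ (proj₂ (two i))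

    member-cases : ∀ i r → member i r ≡ c i ⊎ Private c i (member i r)
    member-cases i Fin.zero                     = inj₁ refl
    member-cases i (Fin.suc Fin.zero)           = inj₂ (proj₁ (proj₂ (proj₂ (proj₂ (two i)))))
    member-cases i (Fin.suc (Fin.suc Fin.zero)) = inj₂ (proj₂ (proj₂ (proj₂ (proj₂ (two i)))))

    private
      c≢p : ∀ i → c i ≢ proj₁ (two i)
      c≢p i = private≢centre (proj₁ (proj₂ (proj₂ (proj₂ (two i)))))

      c≢q : ∀ i → c i ≢ proj₁ (proj₂ (two i))
      c≢q i = private≢centre (proj₂ (proj₂ (proj₂ (proj₂ (two i)))))

      p≢q : ∀ i → proj₁ (two i) ≢ proj₁ (proj₂ (two i))
      p≢q i = proj₁ (proj₂ (proj₂ (two i)))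

      role-injective : ∀ i r s → member i r ≡ member i s → r ≡ s
      role-injective i Fin.zero                     Fin.zero                     _  = refl
      role-injective i Fin.zero                     (Fin.suc Fin.zero)           eq = contradiction eq (c≢p i)
      role-injective i Fin.zero                     (Fin.suc (Fin.suc Fin.zero)) eq = contradiction eq (c≢q i)
      role-injective i (Fin.suc Fin.zero)           Fin.zero                     eq = contradiction (sym eq) (c≢p i)
      role-injective i (Fin.suc Fin.zero)           (Fin.suc Fin.zero)           _  = refl
      role-injective i (Fin.suc Fin.zero)           (Fin.suc (Fin.suc Fin.zero)) eq = contradiction eq (p≢q i)
      role-injective i (Fin.suc (Fin.suc Fin.zero)) Fin.zero                     eq = contradiction (sym eq) (c≢q i)
      role-injective i (Fin.suc (Fin.suc Fin.zero)) (Fin.suc Fin.zero)           eq = contradiction (sym eq) (p≢q i)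
      role-injective i (Fin.suc (Fin.suc Fin.zero)) (Fin.suc (Fin.suc Fin.zero)) _  = refl

      group-injective : ∀ i j r s → member i r ≡ member j s → i ≡ j
      group-injective i j r s eq with member-cases i r | member-cases j s
      ... | inj₂ p | _      = sym (near-private p (near-member eq))
        where
        near-member : member i r ≡ member j s → Near G (c j) (member i r)
        near-member eq with member-cases j s
        ... | inj₁ e       = inj₁ (sym (trans eq e))
        ... | inj₂ (a , _) = inj₂ (subst (Adj G (c j)) (sym eq) a)
      ... | inj₁ e | inj₂ q = contradiction (trans (sym e) eq) (private≢centre q)
      -- The family is not assumed injective: if two centres coincide, a private neighbour of one is
      -- near the other, so the indices agree.
      ... | inj₁ e | inj₁ e′ = near-private (member-p j)
        (inj₂ (subst (λ v → Adj G v (proj₁ (two j))) (sym (trans (sym e) (trans eq e′))) (proj₁ (member-p j))))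
        where
        member-p : ∀ j → Private c j (proj₁ (two j))
        member-p j = proj₁ (proj₂ (proj₂ (proj₂ (two j))))

      pair-injective : ∀ a b → uncurry member a ≡ uncurry member b → a ≡ b
      pair-injective (i , r) (j , s) eq with group-injective i j r s eq
      ... | refl = cong (i ,_) (role-injective i r s eq)

      flat : Fin (suc m * 3) → Fin n
      flat e = uncurry member (Fin.remQuot {suc m} 3 e)

      flat-injective : ∀ {e f} → flat e ≡ flat f → e ≡ f
      flat-injective {e} {f} eq = begin
        e                                             ≡⟨ Fin.combine-remQuot {suc m} 3 e ⟨
        uncurry Fin.combine (Fin.remQuot {suc m} 3 e) ≡⟨ cong (uncurry Fin.combine)
          (pair-injective (Fin.remQuot {suc m} 3 e) (Fin.remQuot {suc m} 3 f) eq) ⟩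
        uncurry Fin.combine (Fin.remQuot {suc m} 3 f) ≡⟨ Fin.combine-remQuot {suc m} 3 f ⟩
        f                                             ∎
        where open ≡-Reasoning

    groups-fit : suc m * 3 ≤ n
    groups-fit = Fin.injective⇒≤ flat-injective

    outsider : (∀ i r → member i r ≢ w) → suc (suc m * 3) ≤ n
    outsider {w} out = Fin.injective⇒≤ {f = extended} extended-injective
      where
      extended : Fin (suc (suc m * 3)) → Fin n
      extended Fin.zero    = w
      extended (Fin.suc e) = flat e

      extended-injective : ∀ {e f} → extended e ≡ extended f → e ≡ f
      extended-injective {Fin.zero}  {Fin.zero}  _  = refl
      extended-injective {Fin.zero}  {Fin.suc f} eq = contradiction (sym eq) (uncurry out (Fin.remQuot {suc m} 3 f))
      extended-injective {Fin.suc e} {Fin.zero}  eq = contradiction eq (uncurry out (Fin.remQuot {suc m} 3 e))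
      extended-injective {Fin.suc e} {Fin.suc f} eq = cong Fin.suc (flat-injective eq)

irreducible : {G : Graph n} → IsγP G (suc m) → (c : Fin m → Fin n) → ¬ Observing G (Range c)
irreducible isγP c obs = ℕ.1+n≰n (isγP⇒≤ isγP c obs)

γP*3≤n : {G : Graph n} → Connected G → 3 ≤ n → IsγP G k → k * 3 ≤ n
γP*3≤n {G = G} conn 3≤n isγP@((c , obs) , _) with isγP⇒positive isγP
... | m , refl =
  let _ , good    = branching-family conn 3≤n c obs
      _ , _ , two = twoPrivate-exists good
  in  Groups.groups-fit two
  where open PrivateNeighbours G (irreducible isγP)

-- Complementary graphs and the case n = 3a

record Complementary (G H : Graph n) : Set where
  field
    disjoint : ∀ {u v} → Adj G u v → ¬ Adj H u v
    cover    : ∀ {u v} → u ≢ v → ¬ Adj G u v → Adj H u v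

open Complementary

complement-complementary : (G : Graph n) → Complementary G (complement G)
complement-complementary G = record
  { disjoint = λ a (_ , ¬a) → ¬a a
  ; cover    = _,_
  }

-- Complementing twice gives back `G` only up to decidability of adjacency. A symmetric relation
-- between `G` and `H` lets every later argument be applied with the roles exchanged.
complementary-sym : {G H : Graph n} → Complementary G H → Complementary H G
complementary-sym {G = G} comp = record
  { disjoint = λ h g → disjoint comp g h
  ; cover    = λ {u} {v} u≢v ¬h →
      decidable-stable (adj? G u v) (λ ¬g → ¬h (cover comp u≢v ¬g))
  }

module Extremal
  {n m : ℕ} {G H : Graph n} (comp : Complementary G H)
  (connG : Connected G) (connH : Connected H)
  (irr : (c : Fin (suc m) → Fin n) → ¬ Observing G (Range c))
  (n≡ : n ≡ suc (suc m) * 3)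
  where

  open PrivateNeighbours G irr

  private
    Family : Set
    Family = Fin (suc (suc m)) → Fin n

    variable
      c : Family
      i j l : Fin (suc (suc m))
      w x y z t : Fin n

  Group : Family → Fin (suc (suc m)) → Pred (Fin n) 0ℓ
  Group c i w = w ≡ c i ⊎ Private c i w

  outside⇒¬two : (∀ i → ¬ Group c i w) → ∃[ i ] ¬ TwoPrivate c i
  outside⇒¬two {c} {w} out with Fin.all? (twoPrivate? c)
  ... | no ¬all = Fin.¬∀⟶∃¬ _ _ (twoPrivate? c) ¬all
  ... | yes two = contradiction
    (ℕ.≤-trans (Groups.outsider two outᵣ) (ℕ.≤-reflexive n≡)) ℕ.1+n≰n
    where
    open Groups two
    outᵣ : ∀ i r → member i r ≢ w
    outᵣ i r refl = out i (member-cases i r)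

  other : (i : Fin (suc (suc m))) → ∃[ j ] j ≢ i
  other i = punchIn i Fin.zero , Fin.punchInᵢ≢i i Fin.zero

  grouped : (∀ i → TwoPrivate c i) → ∀ w → ∃[ i ] Group c i w
  grouped {c} two w with Fin.any? (λ i → (w Fin.≟ c i) ⊎-dec private? c i w)
  ... | yes found = found
  ... | no  none  = let i , ¬two = outside⇒¬two (λ i g → none (i , g))
                    in  contradiction (two i) ¬two

  -- For n = 3a the centres and two private neighbours of each already exhaust the vertices, so
  -- `only` can be demanded: there is no room for a third private neighbour.
  record Pair (c : Family) (i : Fin (suc (suc m))) (x y : Fin n) : Set where
    field
      distinct : x ≢ y
      privateˡ : Private c i x
      privateʳ : Private c i y
      only     : ∀ {w} → Private c i w → w ≡ x ⊎ w ≡ y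

  open Pair

  swap : Pair c i x y → Pair c i y x
  swap p = record
    { distinct = distinct p ∘ sym
    ; privateˡ = privateʳ p
    ; privateʳ = privateˡ p
    ; only     = Sum.swap ∘ only p
    }

  pair : (∀ i → TwoPrivate c i) → ∀ i → ∃[ x ] ∃[ y ] Pair c i x y
  pair {c} two i =
    let x , y , x≢y , px , py = two i
    in  x , y , record
      { distinct = x≢y ; privateˡ = px ; privateʳ = py ; only = only′ }
    where
    open Groups two

    only′ : ∀ {w} → Private c i w → w ≡ proj₁ (two i) ⊎ w ≡ proj₁ (proj₂ (two i))
    only′ {w} pw with w Fin.≟ proj₁ (two i) | w Fin.≟ proj₁ (proj₂ (two i))
    ... | yes eq | _      = inj₁ eq
    ... | no _   | yes eq = inj₂ eq
    ... | no w≢x | no w≢y = contradiction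
      (ℕ.≤-trans (outsider out) (ℕ.≤-reflexive n≡)) ℕ.1+n≰n
      where
      out : ∀ j r → member j r ≢ w
      out j r refl with member-cases j r
      out j r refl | inj₁ eq = private≢centre pw (sym eq)
      out j r refl | inj₂ pj with private-unique pj pw
      out j Fin.zero refl                     | inj₂ pj | refl = private≢centre pj refl
      out j (Fin.suc Fin.zero) refl           | inj₂ pj | refl = w≢x refl
      out j (Fin.suc (Fin.suc Fin.zero)) refl | inj₂ pj | refl = w≢y refl

  pairWith : (∀ i → TwoPrivate c i) → Private c i x → ∃[ y ] Pair c i x y
  pairWith {i = i} two px with pair two i
  ... | y , z , p with only p px
  ...   | inj₁ refl = z , p
  ...   | inj₂ refl = y , swap p

  -- An unlinked centre and its two private neighbours form a group that can
  -- only be left through a private neighbour x.  Moving the centre to x exposes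
  -- a vertex outside all groups, so the family was not optimal.
  link : Good c → (∀ i → TwoPrivate c i) → ¬ Linked c i →
         ∃[ c′ ] Good c′ × links c ⊂ links c′
  link {c} {i} (obs , branching) two ¬li =
    let x , w , px , xw , ¬gw = exit
        y , p  = pairWith two px
        good   = moved xw ¬gw p
        -- The move need not create a link by itself. It leaves some centre without two private
        -- neighbours, and `improve` then creates one.
        _ , ¬two = outside⇒¬two (w-outside px xw ¬gw)
        c″ , good″ , ⊆″ , new = improve good ¬two
    in  c″ , good″ , ⊆″ ∘ links-update i x c ¬li
           , proj₁ new , proj₁ (proj₂ new) , proj₂ (proj₂ new) ∘ links-update i x c ¬li
    where
    exit : ∃[ x ] ∃[ w ] Private c i x × Adj G x w × ¬ Group c i w
    exit with Fin.any? (λ x → Fin.any? λ w →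
                private? c i x ×-dec adj? G x w ×-dec
                ¬? ((w Fin.≟ c i) ⊎-dec private? c i w))
    ... | yes found = found
    ... | no  none  with other i
    ...   | j , j≢i with connected-closure {G = G} connG {Group c i} closed {c i} {c j} (inj₁ refl)
      where
      closed : ∀ {u v} → Group c i u → Adj G u v → Group c i v
      closed {v = v} (inj₁ refl) uv with grouped two v
      ... | l , inj₁ refl = contradiction (l , uv) ¬li
      ... | l , inj₂ pl   = inj₂ (subst (λ l → Private c l v) (sym (near-private pl (inj₂ uv))) pl)
      closed {u} {v} (inj₂ pu) uv with (v Fin.≟ c i) ⊎-dec private? c i v
      ... | yes g = g
      ... | no ¬g = contradiction (u , v , pu , uv , ¬g) none
    ...     | inj₂ pj = contradiction refl (private≢centre pj)
    ...     | inj₁ eq = let _ , _ , _ , px , _ = two i in contradiction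
      (near-private px (inj₂ (subst (λ v → Adj G v _) (sym eq) (proj₁ px)))) j≢i

    moved : Adj G x w → ¬ Group c i w → Pair c i x y → Good (update i x c)
    moved {x} {w} {y} xw ¬gw p =
      (λ v → observed-⊆ f (obs v)) ,
      update-cases i x c {Branching G}
        (c i , w , (λ eq → ¬gw (inj₁ (sym eq))) , symm G (proj₁ (privateˡ p)) , xw)
        (λ l _ → branching l)
      where
      T = Range (update i x c)

      centre : Observed G T (c i)
      centre = near (update-source i x c) (inj₂ (symm G (proj₁ (privateˡ p))))

      -- A vacuous case: a neighbour of the unlinked `c i` is no centre, and belonging to some group
      -- it can only be private to `i`.
      nonprivate : ∀ {v} → Adj G (c i) v → ¬ Private c i v → Observed G T v
      nonprivate {v} iv ¬pv with grouped two v
      ... | l , inj₁ refl = contradiction (l , iv) ¬li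
      ... | l , inj₂ pl   =
        contradiction (subst (λ l → Private c l v) (sym (near-private pl (inj₂ iv))) pl) ¬pv

      f : ∀ {u} → Range c u → ∀ {v} → Near G u v → Observed G T v
      f (l , refl) nr with l Fin.≟ i
      f (l , refl) nr          | no l≢i   = near (update-others i x c (l , l≢i , refl)) nr
      f (l , refl) (inj₁ refl) | yes refl = centre
      f (l , refl) {v} (inj₂ iv) | yes refl with private? c i v
      ... | no ¬pv = nonprivate iv ¬pv
      ... | yes pv with only p pv
      ...   | inj₁ refl = source (update-source i x c)
      ...   | inj₂ refl = force centre iv rest
        where
        rest : ∀ {u} → Adj G (c i) u → u ≢ y → Observed G T u
        rest {u} iu u≢y with private? c i u
        ... | no ¬pu = nonprivate iu ¬pu
        ... | yes pu with only p pu
        ...   | inj₁ refl = source (update-source i x c)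
        ...   | inj₂ eq   = contradiction eq u≢y

    -- `w` is private to some other `l₀` in the old family. After the move it is adjacent to the two
    -- centres `x` and `c l₀`, hence private to neither.
    w-outside : Private c i x → Adj G x w → ¬ Group c i w →
                ∀ l → ¬ Group (update i x c) l w
    w-outside {x} {w} px xw ¬gw l g with grouped two w
    ... | l₀ , inj₁ refl = ¬gw (inj₁ (cong c (near-private px (inj₂ (symm G xw)))))
    ... | l₀ , inj₂ p₀ with l₀ Fin.≟ i
    ...   | yes refl = ¬gw (inj₂ p₀)
    ...   | no l₀≢i  = go g
      where
      go : Group (update i x c) l w → _
      go (inj₁ eq) = update-cases i x c {w ≢_}
        (λ { refl → irrefl G refl xw }) (λ j _ eq → private≢centre p₀ (sym eq)) l eq
      go (inj₂ pl) with near-private pl (subst (λ v → Near G v w) (sym (update-at i x c)) (inj₂ xw))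
                      | near-private pl (subst (λ v → Near G v w) (sym (update-away i x c l₀≢i)) (inj₂ (proj₁ p₀)))
      ... | refl | eq = l₀≢i eq

  linked-exists : Good c → ∃[ c′ ] (∀ i → TwoPrivate c′ i) × (∀ i → Linked c′ i)
  linked-exists good = go good (⊃-wellFounded _)
    where
    step : Good c → ((∀ i → TwoPrivate c i) × (∀ i → Linked c i)) ⊎
                    (∃[ c′ ] Good c′ × links c ⊂ links c′)
    step {c} good with Fin.all? (twoPrivate? c)
    ... | no ¬all = inj₂ (improve good (proj₂ (Fin.¬∀⟶∃¬ _ _ (twoPrivate? c) ¬all)))
    ... | yes two with Fin.all? (linked? c)
    ...   | yes linked = inj₁ (two , linked)
    ...   | no ¬all = inj₂ (link good two (proj₂ (Fin.¬∀⟶∃¬ _ _ (linked? c) ¬all)))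

    go : Good c → Acc _⊃_ (links c) → ∃[ c′ ] (∀ i → TwoPrivate c′ i) × (∀ i → Linked c′ i)
    go {c} good (acc rec) with step good
    ... | inj₁ done                  = c , done
    ... | inj₂ (_ , good′ , bigger) = go good′ (rec bigger)

  module Twins {c : Family} (two : ∀ i → TwoPrivate c i) (linked : ∀ i → Linked c i) where

    private
      linked-others : ∀ i → ∃[ j ] j ≢ i × Adj G (c j) (c i)
      linked-others i = let j , a = linked i in
        j , (λ eq → irrefl G (cong c (sym eq)) a) , symm G a

    -- Suppose `z` is adjacent to `x` but not to `y`, and drop the centre `c i`. Being linked, `c i`
    -- is still observed, and so is everything except `x` and `y`. Then `z` forces `x` and `c i`
    -- forces `y`, which saves a centre.
    twin : Pair c i x y → j ≢ i → Private c j z → Adj G z x → Adj G z y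
    twin {i} {x} {y} {j} {z} p j≢i pz zx = decidable-stable (adj? G z y) λ ¬zy →
      let z∈ : Observed G (Others c i) z
          z∈ = near (j , j≢i , refl) (inj₂ (proj₁ pz))
          l , l≢i , li = linked-others i
          i∈ : Observed G (Others c i) (c i)
          i∈ = near (l , l≢i , refl) (inj₂ li)
          x∈ = force z∈ zx λ {u} zu u≢x → nonprivate u λ pu →
                 Sum.[ u≢x , (λ { refl → ¬zy zu }) ] (only p pu)
          y∈ = force i∈ (proj₁ (privateʳ p)) λ {u} iu u≢y → either (λ pu →
                 Sum.[ (λ { refl → x∈ }) , (λ eq → contradiction eq u≢y) ] (only p pu))
      in  others-insufficient i λ u → either λ pu →
            Sum.[ (λ { refl → x∈ }) , (λ { refl → y∈ }) ] (only p pu)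
      where
      nonprivate : ∀ u → ¬ Private c i u → Observed G (Others c i) u
      nonprivate u ¬pu with grouped two u
      ... | l , g with l Fin.≟ i
      nonprivate u ¬pu | l , inj₁ refl | no l≢i = source (l , l≢i , refl)
      nonprivate u ¬pu | l , inj₂ pl   | no l≢i = near (l , l≢i , refl) (inj₂ (proj₁ pl))
      nonprivate u ¬pu | l , inj₂ pl   | yes refl = contradiction pl ¬pu
      nonprivate u ¬pu | l , inj₁ refl | yes refl =
        let j , j≢l , jl = linked-others l in near (j , j≢l , refl) (inj₂ jl)

      either : ∀ {u} → (Private c i u → Observed G (Others c i) u) → Observed G (Others c i) u
      either {u} f with private? c i u
      ... | yes pu = f pu
      ... | no ¬pu = nonprivate u ¬pu

    twin′ : Private c i x → Private c i y → j ≢ i → Private c j z → Adj G z x → Adj G z y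
    twin′ {y = y} px py j≢i pz zx with pairWith two px
    ... | _ , p with only p py
    ...   | inj₁ refl = zx
    ...   | inj₂ refl = twin p j≢i pz zx

    joined-all : i ≢ j → Private c i x → Private c j z → Adj G x z →
                 Private c i y → Private c j t → Adj G y t
    joined-all i≢j px pz xz py pt =
      symm G (twin′ px py (i≢j ∘ sym) pt (symm G (twin′ pz pt i≢j px xz)))

    Swapped : Fin (suc (suc m)) → Fin (suc (suc m)) → Fin n → Pred (Fin n) 0ℓ
    Swapped i j x v = (∃[ l ] l ≢ i × l ≢ j × c l ≡ v) ⊎ v ≡ x

    -- `x` takes the place of `c j` and nothing takes that of `c i`, so there is one centre fewer.
    swapped-insufficient : i ≢ j → ¬ Observing G (Swapped i j x)
    swapped-insufficient {i} {j} {x} i≢j obs =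
      others-insufficient {update j x c} i λ u → observed-mono f (obs u)
      where
      f : ∀ {v} → Swapped i j x v → Others (update j x c) i v
      f (inj₁ (l , l≢i , l≢j , refl)) = l , l≢i , update-away j x c l≢j
      f (inj₂ refl)                   = j , i≢j ∘ sym , update-at j x c

    -- If private neighbours of i and j are adjacent, then x together with the
    -- centres other than i and j observes everything but c j and y, and does
    -- not observe either of these, since observing one forces the other.
    module Joined (i≢j : i ≢ j) (p : Pair c i x y) (pz : Private c j z) (xz : Adj G x z) where

      private
        Obs : Pred (Fin n) 0ℓ
        Obs = Observed G (Swapped i j x)

        x-near : ∀ {v} → Adj G x v → Obs v
        x-near = near (inj₂ refl) ∘ inj₂

        other-group : ∀ {v} → l ≢ i → l ≢ j → Group c l v → Obs v
        other-group l≢i l≢j (inj₁ refl) = source (inj₁ (_ , l≢i , l≢j , refl))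
        other-group l≢i l≢j (inj₂ pl)   = near (inj₁ (_ , l≢i , l≢j , refl)) (inj₂ (proj₁ pl))

        rest : ∀ v → v ≢ c j → v ≢ y → Obs v
        rest v v≢j v≢y with grouped two v
        ... | l , g with l Fin.≟ i | l Fin.≟ j
        rest v v≢j v≢y | l , g         | no l≢i   | no l≢j   = other-group l≢i l≢j g
        rest v v≢j v≢y | l , inj₁ refl | yes refl | _        = x-near (symm G (proj₁ (privateˡ p)))
        rest v v≢j v≢y | l , inj₁ eq   | no _     | yes refl = contradiction eq v≢j
        rest v v≢j v≢y | l , inj₂ pv   | no _     | yes refl =
          x-near (twin′ pz pv i≢j (privateˡ p) xz)
        rest v v≢j v≢y | l , inj₂ pv   | yes refl | _ with only p pv
        ... | inj₁ refl = source (inj₂ refl)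
        ... | inj₂ eq   = contradiction eq v≢y

        i∈ : Obs (c i)
        i∈ = x-near (symm G (proj₁ (privateˡ p)))

        not-both : Obs y → ¬ Obs (c j)
        not-both y∈ j∈ = swapped-insufficient i≢j all
          where
          all : ∀ v → Obs v
          all v with v Fin.≟ c j | v Fin.≟ y
          ... | yes refl | _        = j∈
          ... | no _     | yes refl = y∈
          ... | no v≢j   | no v≢y   = rest v v≢j v≢y

        ¬centre : ¬ Obs (c j)
        ¬centre j∈ = not-both (force i∈ (proj₁ (privateʳ p)) others) j∈
          where
          others : ∀ {u} → Adj G (c i) u → u ≢ y → Obs u
          others {u} _ u≢y with u Fin.≟ c j
          ... | yes refl = j∈
          ... | no u≢j   = rest u u≢j u≢y

      -- Any other centre linked to `c j` is still present and would observe it. So the link that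
      -- `c j` must have is to `c i`.
      centre-links : Adj G (c j) (c l) → l ≡ i
      centre-links {l} jl with l Fin.≟ i
      ... | yes eq  = eq
      ... | no  l≢i = contradiction
        (near (inj₁ (l , l≢i , (λ { refl → irrefl G refl jl }) , refl)) (inj₂ (symm G jl)))
        ¬centre

      centres-adjacent : Adj G (c i) (c j)
      centres-adjacent with linked j
      ... | l , jl with centre-links jl
      ...   | refl = symm G jl

      private
        ¬last : ¬ Obs y
        ¬last y∈ = ¬centre (force i∈ centres-adjacent others)
          where
          others : ∀ {u} → Adj G (c i) u → u ≢ c j → Obs u
          others {u} _ u≢j with u Fin.≟ y
          ... | yes refl = y∈
          ... | no u≢y   = rest u u≢j u≢y

      privates-nonadjacent : ¬ Adj G x y
      privates-nonadjacent xy = ¬last (x-near xy)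

      -- `w` is observed and, being private to `l`, not adjacent to `c j`; if adjacent to `y`, it
      -- would have `y` as its only unobserved neighbour and force it.
      other-nonadjacent : l ≢ i → l ≢ j → Private c l w → ¬ Adj G w y
      other-nonadjacent l≢i l≢j pw wy =
        ¬last (force (other-group l≢i l≢j (inj₂ pw)) wy λ {u} wu u≢y →
          rest u (λ { refl → l≢j (sym (near-private pw (inj₂ (symm G wu)))) }) u≢y)

    -- Two joined groups would form a copy of K₃,₃ without further edges.
    private-separated : i ≢ j → Private c i x → Private c j z → ¬ Adj G x z
    private-separated {i} {j} {x} {z} i≢j px pz xz
      with connected-closure {G = H} connH {Side} sideClosed {c i} {c j} (inj₁ refl)
      where
      half : ∀ {i j x z} → i ≢ j → Private c i x → Private c j z → Adj G x z →
             (∀ {l} → Adj G (c j) (c l) → l ≡ i) ×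
             (∀ {u v} → Private c i u → Private c i v → ¬ Adj G u v) ×
             (∀ {l u v} → l ≢ i → l ≢ j → Private c l u → Private c i v → ¬ Adj G u v) ×
             Adj G (c i) (c j)
      half {i} {j} {x} {z} i≢j px pz xz =
        let _ , p = pairWith two px
        in  Joined.centre-links i≢j p pz xz , nonadj , apart , Joined.centres-adjacent i≢j p pz xz
        where
        nonadj : ∀ {u v} → Private c i u → Private c i v → ¬ Adj G u v
        nonadj pu pv uv with pairWith two pu
        ... | _ , p with only p pv
        ...   | inj₁ refl = irrefl G refl uv
        ...   | inj₂ refl = Joined.privates-nonadjacent i≢j p pz (joined-all i≢j px pz xz pu pz) uv

        apart : ∀ {l u v} → l ≢ i → l ≢ j → Private c l u → Private c i v → ¬ Adj G u v
        apart l≢i l≢j pu pv uv with pairWith two pv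
        ... | _ , p = Joined.other-nonadjacent i≢j (swap p) pz
                        (joined-all i≢j px pz xz (privateʳ p) pz) l≢i l≢j pu uv

      -- `Both` is closed under adjacency in `G`, hence everything. `Side` is one colour class of
      -- K₃,₃; as `G` has all edges between the classes, `H` has none, and `c i` cannot reach `c j`
      -- in `H`.
      Both Side : Pred (Fin n) 0ℓ
      Both v = Group c i v ⊎ Group c j v
      Side v = v ≡ c i ⊎ Private c j v

      half-closed : ∀ {i j x z} → i ≢ j → Private c i x → Private c j z → Adj G x z →
                    ∀ {u v} → Group c i u → Adj G u v → Group c i v ⊎ Group c j v
      half-closed {i} {j} i≢j px pz xz {v = v} gu uv with grouped two v
      ... | l , g with l Fin.≟ i | l Fin.≟ j
      half-closed i≢j px pz xz gu uv | l , g | yes refl | _        = inj₁ g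
      half-closed i≢j px pz xz gu uv | l , g | no _     | yes refl = inj₂ g
      half-closed i≢j px pz xz (inj₁ refl) uv | l , inj₁ refl | no l≢i | no l≢j =
        contradiction (proj₁ (half (i≢j ∘ sym) pz px (symm G xz)) uv) l≢j
      half-closed i≢j px pz xz (inj₁ refl) uv | l , inj₂ pv | no l≢i | no l≢j =
        contradiction (sym (near-private pv (inj₂ uv))) l≢i
      half-closed i≢j px pz xz (inj₂ pu) uv | l , inj₁ refl | no l≢i | no l≢j =
        contradiction (near-private pu (inj₂ (symm G uv))) l≢i
      half-closed i≢j px pz xz (inj₂ pu) uv | l , inj₂ pv | no l≢i | no l≢j =
        contradiction (symm G uv) (proj₁ (proj₂ (proj₂ (half i≢j px pz xz))) l≢i l≢j pv pu)

      closed : ∀ {u v} → Both u → Adj G u v → Both v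
      closed (inj₁ gu) uv = half-closed i≢j px pz xz gu uv
      closed (inj₂ gu) uv = Sum.swap (half-closed (i≢j ∘ sym) pz px (symm G xz) gu uv)

      both : ∀ v → Both v
      both v = connected-closure {G = G} connG {Both} closed {c i} {v} (inj₁ (inj₁ refl))

      ij : Adj G (c i) (c j)
      ij = proj₂ (proj₂ (proj₂ (half i≢j px pz xz)))

      sideClosed : ∀ {u v} → Side u → Adj H u v → Side v
      sideClosed {v = v} su h with both v
      ... | inj₁ (inj₁ eq) = inj₁ eq
      ... | inj₂ (inj₂ pv) = inj₂ pv
      sideClosed (inj₁ refl) h | inj₁ (inj₂ pv)   = contradiction h (disjoint comp (proj₁ pv))
      sideClosed (inj₁ refl) h | inj₂ (inj₁ refl) = contradiction h (disjoint comp ij)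
      sideClosed (inj₂ pu)   h | inj₁ (inj₂ pv)   = contradiction h
        (disjoint comp (symm G (joined-all i≢j px pz xz pv pu)))
      sideClosed (inj₂ pu)   h | inj₂ (inj₁ refl) = contradiction h
        (disjoint comp (symm G (proj₁ pu)))
    ... | inj₁ eq = i≢j (sym (near-private px (inj₂ (subst (λ v → Adj G v x) (sym eq) (proj₁ px)))))
    ... | inj₂ pj = private≢centre pj refl

    -- In `H`, `x` dominates all but its neighbours in `G`, which are `c i` and possibly `y`. A
    -- centre `c j` linked to `c i` is not adjacent to it in `H`, so it forces `y`; then a private
    -- neighbour of `c j` forces `c i`.
    private-observes : Private c i x → Observing H (_≡ x)
    private-observes {i} {x} px with pairWith two px | linked-others i
    ... | y , p | j , j≢i , ji = all
      where
      Obs : Pred (Fin n) 0ℓ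
      Obs = Observed H (_≡ x)

      rest : ∀ v → v ≢ c i → v ≢ y → Obs v
      rest v v≢i v≢y with v Fin.≟ x
      ... | yes refl = source refl
      ... | no  v≢x  = near refl (inj₂ (cover comp (v≢x ∘ sym) ¬xv))
        where
        ¬xv : ¬ Adj G x v
        ¬xv xv with grouped two v
        ... | l , g with l Fin.≟ i
        ¬xv xv | l , inj₁ refl | yes refl = v≢i refl
        ¬xv xv | l , inj₁ refl | no l≢i   = l≢i (near-private px (inj₂ (symm G xv)))
        ¬xv xv | l , inj₂ pv   | no l≢i   = private-separated (l≢i ∘ sym) px pv xv
        ¬xv xv | l , inj₂ pv   | yes refl with only p pv
        ... | inj₁ eq = v≢x eq
        ... | inj₂ eq = v≢y eq

      j∈ : Obs (c j)
      j∈ = rest (c j) (λ eq → irrefl G eq ji) (private≢centre (privateʳ p))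

      y∈ : Obs y
      y∈ = force j∈
        (cover comp (private≢centre (privateʳ p)) (λ jy → j≢i (near-private (privateʳ p) (inj₂ jy))))
        λ {u} ju u≢y → rest u (λ { refl → disjoint comp ji ju }) u≢y

      i∈ : Obs (c i)
      i∈ = let z , _ , _ , pz , _ = two j
               iz = λ (a : Adj G z (c i)) → j≢i (sym (near-private pz (inj₂ (symm G a))))
               z∈ = rest z (λ eq → private≢centre pz (sym eq))
                      (λ { refl → j≢i (private-unique pz (privateʳ p)) })
           in  force z∈ (cover comp (λ eq → private≢centre pz (sym eq)) iz)
                 λ {u} _ u≢i → lastly u u≢i
        where
        lastly : ∀ u → u ≢ c i → Obs u
        lastly u u≢i with u Fin.≟ y
        ... | yes refl = y∈
        ... | no u≢y   = rest u u≢i u≢y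

      all : ∀ v → Obs v
      all v with v Fin.≟ c i | v Fin.≟ y
      ... | yes refl | _        = i∈
      ... | no _     | yes refl = y∈
      ... | no v≢i   | no v≢y   = rest v v≢i v≢y

  extremal⇒observer : Good c → ∃[ x ] Observing H (_≡ x)
  extremal⇒observer good =
    let _ , two , linked = linked-exists good
        x , _ , _ , px , _ = two Fin.zero
    in  x , Twins.private-observes two linked px

extremal⇒complement≤1 : {G H : Graph n} → Complementary G H → Connected G → Connected H →
                        3 ≤ n → IsγP G k → 2 ≤ k → n ≡ k * 3 → ∀ {h} → IsγP H h → h ≤ 1
extremal⇒complement≤1 {G = G} {H} comp connG connH 3≤n isγP@((c , obs) , _) (s≤s (s≤s z≤n)) n≡ (_ , minimal) =
  let _ , good = branching-family connG 3≤n c obs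
      x , observes = Extremal.extremal⇒observer {G = G} {H} comp connG connH (irreducible isγP) n≡ good
  in  minimal (x ∷ []) λ w → observed-mono (λ { refl → here refl }) (observes w)

-- Sums and double counting

indicator : {P : Set} → Dec P → ℕ
indicator (yes _) = 1
indicator (no  _) = 0

indicator-× : {P Q : Set} (p? : Dec P) (q? : Dec Q) →
              indicator (p? ×-dec q?) ≡ indicator p? * indicator q?
indicator-× (yes _) (yes _) = refl
indicator-× (yes _) (no  _) = refl
indicator-× (no  _) (yes _) = refl
indicator-× (no  _) (no  _) = refl

∑ : {A : Set} → List A → (A → ℕ) → ℕ
∑ xs f = sum (map f xs)

module _ {A : Set} where

  ∑-cong : ∀ (xs : List A) {f g} → (∀ x → f x ≡ g x) → ∑ xs f ≡ ∑ xs g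
  ∑-cong xs f≡g = cong sum (map-cong f≡g xs)

  ∑-mono : ∀ (xs : List A) {f g} → (∀ x → f x ≤ g x) → ∑ xs f ≤ ∑ xs g
  ∑-mono []       f≤g = z≤n
  ∑-mono (x ∷ xs) f≤g = ℕ.+-mono-≤ (f≤g x) (∑-mono xs f≤g)

  ∑-const : ∀ (xs : List A) b → ∑ xs (λ _ → b) ≡ length xs * b
  ∑-const []       b = refl
  ∑-const (x ∷ xs) b = cong (b +_) (∑-const xs b)

  ∑-+ : ∀ (xs : List A) f g → ∑ xs (λ x → f x + g x) ≡ ∑ xs f + ∑ xs g
  ∑-+ []       f g = refl
  ∑-+ (x ∷ xs) f g rewrite ∑-+ xs f g = interchange (f x) (g x) (∑ xs f) (∑ xs g)

  ∑-*ˡ : ∀ (xs : List A) b f → ∑ xs (λ x → b * f x) ≡ b * ∑ xs f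
  ∑-*ˡ []       b f = sym (ℕ.*-zeroʳ b)
  ∑-*ˡ (x ∷ xs) b f rewrite ∑-*ˡ xs b f = sym (ℕ.*-distribˡ-+ b (f x) (∑ xs f))

  ∑-*ʳ : ∀ (xs : List A) b f → ∑ xs (λ x → f x * b) ≡ ∑ xs f * b
  ∑-*ʳ []       b f = refl
  ∑-*ʳ (x ∷ xs) b f rewrite ∑-*ʳ xs b f = sym (ℕ.*-distribʳ-+ b (f x) (∑ xs f))

  length-filter≡∑ : {P : Pred A 0ℓ} (P? : U.Decidable P) (xs : List A) →
                    length (filter P? xs) ≡ ∑ xs (indicator ∘ P?)
  length-filter≡∑ P? []       = refl
  length-filter≡∑ P? (x ∷ xs) with P? x
  ... | yes _ = cong suc (length-filter≡∑ P? xs)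
  ... | no  _ = length-filter≡∑ P? xs

  -- Removing the first element removes a row and a column with equal sums and a zero on the
  -- diagonal.
  ∑-symmetric-even : (f : A → A → ℕ) → (∀ x → f x x ≡ 0) → (∀ x y → f x y ≡ f y x) →
                     (xs : List A) → ∃[ h ] ∑ xs (λ x → ∑ xs (f x)) ≡ h + h
  ∑-symmetric-even f zero-diagonal symmetric []       = 0 , refl
  ∑-symmetric-even f zero-diagonal symmetric (x ∷ xs) =
    let h , eq = ∑-symmetric-even f zero-diagonal symmetric xs
        s = ∑ xs (f x)
    in  s + h , (begin
      (f x x + s) + ∑ xs (λ y → f y x + ∑ xs (f y))
        ≡⟨ cong₂ (λ a b → (a + s) + b) (zero-diagonal x) (∑-+ xs (λ y → f y x) (λ y → ∑ xs (f y))) ⟩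
      s + (∑ xs (λ y → f y x) + ∑ xs (λ y → ∑ xs (f y)))
        ≡⟨ cong₂ (λ a b → s + (a + b)) (∑-cong xs (λ y → symmetric y x)) eq ⟩
      s + (s + (h + h))
        ≡⟨ ℕ.+-assoc s s (h + h) ⟨
      (s + s) + (h + h)
        ≡⟨ interchange s s h h ⟩
      (s + h) + (s + h) ∎)
    where open ≡-Reasoning

∑-swap : {A B : Set} (xs : List A) (ys : List B) (f : A → B → ℕ) →
         ∑ xs (λ x → ∑ ys (f x)) ≡ ∑ ys (λ y → ∑ xs (λ x → f x y))
∑-swap []       ys f = sym (trans (∑-const ys 0) (ℕ.*-zeroʳ (length ys)))
∑-swap (x ∷ xs) ys f =
  trans (cong (∑ ys (f x) +_) (∑-swap xs ys f)) (sym (∑-+ ys (f x) (λ y → ∑ xs (λ x → f x y))))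

length-allFin : ∀ n → length (allFin n) ≡ n
length-allFin n = length-tabulate {n = n} (λ i → i)

∑-≟ : (v : Fin n) → ∑ (allFin n) (λ w → indicator (v Fin.≟ w)) ≡ 1
∑-≟ {n} v = trans (sym (length-filter≡∑ (v Fin.≟_) (allFin n)))
  (ℕ.≤-antisym
    (at-most-one (Unique.filter⁺ (v Fin.≟_) (Unique.allFin⁺ n))
      (λ x∈ → proj₂ (∈-filter⁻ (v Fin.≟_) {xs = allFin n} x∈)))
    (nonempty-length (∈-filter⁺ (v Fin.≟_) (∈-allFin v) refl)))
  where
  at-most-one : ∀ {xs : List (Fin n)} → Unique xs → (∀ {x} → x ∈ xs → v ≡ x) → length xs ≤ 1
  at-most-one {[]}         _                 _  = z≤n
  at-most-one {_ ∷ []}     _                 _  = s≤s z≤n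
  at-most-one {_ ∷ _ ∷ _} ((x≢y ∷ _) ∷ _) eq =
    contradiction (trans (sym (eq (here refl))) (eq (there (here refl)))) x≢y

  nonempty-length : ∀ {xs : List (Fin n)} {x} → x ∈ xs → 1 ≤ length xs
  nonempty-length (here _)  = s≤s z≤n
  nonempty-length (there _) = s≤s z≤n

module _ {n : ℕ} where

  ∑ⱽ : (Fin n → ℕ) → ℕ
  ∑ⱽ = ∑ (allFin n)

  ∑ⱽ-const : ∀ b → ∑ⱽ (λ _ → b) ≡ n * b
  ∑ⱽ-const b = trans (∑-const (allFin n) b) (cong (_* b) (length-allFin n))

  vertices : {P : Pred (Fin n) 0ℓ} → U.Decidable P → List (Fin n)
  vertices P? = filter P? (allFin n)

  ∈-vertices : {P : Pred (Fin n) 0ℓ} (P? : U.Decidable P) → ∀ {v} → P v → v ∈ vertices P?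
  ∈-vertices P? {v} pv = ∈-filter⁺ P? (∈-allFin v) pv

  length-vertices : {P : Pred (Fin n) 0ℓ} (P? : U.Decidable P) →
                    length (vertices P?) ≡ ∑ⱽ (indicator ∘ P?)
  length-vertices P? = length-filter≡∑ P? (allFin n)

-- The product bound ab ≤ n

-- The partition argument of Jaeger and Payan: if the classes of a partition of
-- the vertices into k dominated classes are not all of size b, some vertex x is
-- adjacent to all of a class i not containing it.  If x dominates its own class
-- as well, two classes merge; otherwise moving x to class i increases the set
-- of vertices that dominate their own class.
module JaegerPayan
  {G H : Graph n} (comp : Complementary G H) {b : ℕ}
  (large : ∀ xs → Dominating H (_∈ xs) → b ≤ length xs)
  where

  private
    variable
      f : Fin n → Fin k

  Partition : (Fin k → Fin n) → (Fin n → Fin k) → Set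
  Partition c f = ∀ v → Near G (c (f v)) v

  Dominator : (Fin n → Fin k) → Pred (Fin n) 0ℓ
  Dominator f x = ∀ y → f y ≡ f x → Near G x y

  dominator? : (f : Fin n → Fin k) → U.Decidable (Dominator f)
  dominator? f x = Fin.all? λ y → (f y Fin.≟ f x) →-dec near? G x y

  dominators : (Fin n → Fin k) → Subset n
  dominators f = comprehension (dominator? f)

  classes-large : (f : Fin n → Fin k) → (∀ i → b ≤ length (vertices (λ v → f v Fin.≟ i))) → k * b ≤ n
  classes-large {k} f big = begin
    k * b                                                     ≡⟨ ∑ⱽ-const {k} b ⟨
    ∑ⱽ {k} (λ _ → b)                                          ≤⟨ ∑-mono (allFin k) big ⟩
    ∑ⱽ (λ i → length (vertices (λ v → f v Fin.≟ i)))          ≡⟨ ∑-cong (allFin k) (λ i → length-vertices (λ v → f v Fin.≟ i)) ⟩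
    ∑ⱽ (λ i → ∑ⱽ (λ v → indicator (f v Fin.≟ i)))             ≡⟨ ∑-swap (allFin k) (allFin n) (λ i v → indicator (f v Fin.≟ i)) ⟩
    ∑ⱽ (λ v → ∑ⱽ (λ i → indicator (f v Fin.≟ i)))             ≡⟨ ∑-cong (allFin n) (λ v → ∑-≟ (f v)) ⟩
    ∑ⱽ {n} (λ _ → 1)                                          ≡⟨ ∑ⱽ-const {n} 1 ⟩
    n * 1                                                     ≡⟨ ℕ.*-identityʳ n ⟩
    n                                                         ∎
    where open ℕ.≤-Reasoning

  -- A class with fewer than `b` vertices does not dominate `H`. A vertex that it fails to dominate
  -- lies outside it and is adjacent in `G` to all of it.
  small⇒joined : ∀ i → ¬ (b ≤ length (vertices (λ v → f v Fin.≟ i))) →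
                 ∃[ x ] f x ≢ i × (∀ y → f y ≡ i → Adj G x y)
  small⇒joined {f = f} i small with Fin.any? (λ x → ¬? (f x Fin.≟ i) ×-dec
                                      Fin.all? λ y → (f y Fin.≟ i) →-dec adj? G x y)
  ... | yes found = found
  ... | no  none  = contradiction (large _ dominating) small
    where
    dominating : Dominating H (_∈ vertices (λ v → f v Fin.≟ i))
    dominating w with Fin.any? (λ v → (f v Fin.≟ i) ×-dec near? H v w)
    ... | yes (v , fv≡i , vw) = v , ∈-vertices (λ v → f v Fin.≟ i) fv≡i , vw
    ... | no  ¬near = contradiction (w , (λ fw≡i → ¬near (w , fw≡i , inj₁ refl)) , joined) none
      where
      joined : ∀ y → f y ≡ i → Adj G w y
      joined y fy≡i = decidable-stable (adj? G w y) λ ¬wy → ¬near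
        (y , fy≡i , inj₂ (symm H (cover comp (λ { refl → ¬near (w , fy≡i , inj₁ refl) }) ¬wy)))

  Result : Set
  Result = ∃[ k ] Σ[ c ∈ (Fin k → Fin n) ] Dominating G (Range c) × k * b ≤ n

  module Move {m} (c : Fin (suc m) → Fin n) {f : Fin n → Fin (suc m)} (part : Partition c f)
              {x i} (x∉i : f x ≢ i) (joined : ∀ y → f y ≡ i → Adj G x y) where

    merge : Dominator f x → Σ[ c′ ∈ (Fin m → Fin n) ] Dominating G (Range c′)
    merge dom = c₁ ∘ punchIn i , λ w → c₁ (g w)
      , (punchOut (g≢i w ∘ sym) , cong c₁ (Fin.punchIn-punchOut (g≢i w ∘ sym)))
      , near-g w
      where
      c₁ : Fin (suc m) → Fin n
      c₁ = updateAt c (f x) λ _ → x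

      g : Fin n → Fin (suc m)
      g w with f w Fin.≟ i
      ... | yes _ = f x
      ... | no  _ = f w

      g≢i : ∀ w → g w ≢ i
      g≢i w with f w Fin.≟ i
      ... | yes _    = x∉i
      ... | no  fw≢i = fw≢i

      x-near : ∀ {w} → Near G x w → Near G (c₁ (f x)) w
      x-near {w} = subst (λ v → Near G v w) (sym (updateAt-updates (f x) c))

      near-g : ∀ w → Near G (c₁ (g w)) w
      near-g w with f w Fin.≟ i
      ... | yes fw≡i = x-near (inj₂ (joined w fw≡i))
      ... | no  _ with f w Fin.≟ f x
      ...   | yes eq = subst (λ j → Near G (c₁ j) w) (sym eq) (x-near (dom w eq))
      ...   | no  ne = subst (λ v → Near G v w) (sym (updateAt-minimal (f w) (f x) c ne)) (part w)

    moved : Fin n → Fin (suc m)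
    moved w with w Fin.≟ x
    ... | yes _ = i
    ... | no  _ = f w

    moved-partition : Partition (updateAt c i λ _ → x) moved
    moved-partition w with w Fin.≟ x
    ... | yes refl = inj₁ (updateAt-updates i c)
    ... | no  _ with f w Fin.≟ i
    ...   | yes refl = subst (λ v → Near G v w) (sym (updateAt-updates i c)) (inj₂ (joined w refl))
    ...   | no  fw≢i = subst (λ v → Near G v w) (sym (updateAt-minimal (f w) i c fw≢i)) (part w)

    -- In class `i` the vertex `x` is adjacent to all, and all are adjacent to `x`, so no dominator
    -- there is lost; the class that `x` leaves only gets smaller.
    moved-dominators : ¬ Dominator f x → dominators f ⊂ dominators moved
    moved-dominators ¬dom =
      (λ {y} y∈ → ∈-comprehension⁺ (dominator? moved) (old-dominator y (∈-comprehension⁻ (dominator? f) y∈)))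
      , x , ∈-comprehension⁺ (dominator? moved) new-dominator
      , ¬dom ∘ ∈-comprehension⁻ (dominator? f)
      where
      moved-x : moved x ≡ i
      moved-x with x Fin.≟ x
      ... | yes _  = refl
      ... | no x≢x = contradiction refl x≢x

      new-dominator : Dominator moved x
      new-dominator y eq with y Fin.≟ x | trans eq moved-x
      ... | yes y≡x | _    = inj₁ (sym y≡x)
      ... | no  _   | fy≡i = inj₂ (joined y fy≡i)

      old-dominator : ∀ y → Dominator f y → Dominator moved y
      old-dominator y dom z eq with y Fin.≟ x | z Fin.≟ x
      ... | yes refl | _        = contradiction dom ¬dom
      ... | no _     | yes refl = inj₂ (symm G (joined y (sym eq)))
      ... | no _     | no _     = dom z eq

  result : ∀ k (c : Fin k → Fin n) → Dominating G (Range c) → Result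
  result zero    c dom = 0 , c , dom , z≤n
  result (suc m) c dom = go c (proj₁ ∘ proj₁ ∘ proj₂ ∘ dom) part (⊃-wellFounded _)
    where
    part : Partition c (proj₁ ∘ proj₁ ∘ proj₂ ∘ dom)
    part v with dom v
    ... | _ , (i , refl) , nr = nr

    go : ∀ c f → Partition c f → Acc _⊃_ (dominators f) → Result
    go c f part (acc rec) with Fin.all? (λ i → b ℕ.≤? length (vertices (λ v → f v Fin.≟ i)))
    ... | yes big = suc m , c , (λ v → c (f v) , (f v , refl) , part v) , classes-large f big
    ... | no ¬big with Fin.¬∀⟶∃¬ _ _ (λ i → b ℕ.≤? length (vertices (λ v → f v Fin.≟ i))) ¬big
    ...   | i , small with small⇒joined i small
    ...     | x , x∉i , joined with dominator? f x
    ...       | yes d = let c′ , dom′ = Move.merge c part x∉i joined d in result m c′ dom′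
    ...       | no ¬d = go (updateAt c i λ _ → x) (Move.moved c part x∉i joined) (Move.moved-partition c part x∉i joined)
                          (rec (Move.moved-dominators c part x∉i joined ¬d))

-- Dominating sets are power dominating, so `b` bounds those of `H` from below and `a` bounds the
-- number of classes. The partition into singletons is the starting point.
isγP-product : {G H : Graph n} → Complementary G H → ∀ {a b} → IsγP G a → IsγP H b → a * b ≤ n
isγP-product {n} {G} {H} comp {a} {b} γG γH =
  let k , c , dom , k*b≤n = JaegerPayan.result comp
        (λ xs dom → proj₂ γH xs (dominating⇒observing dom))
        n (λ v → v) (λ v → v , (v , refl) , inj₁ refl)
  in  ℕ.≤-trans (ℕ.*-monoˡ-≤ b (isγP⇒≤ γG c (dominating⇒observing dom))) k*b≤n

-- Degrees, common neighbours and the greedy choice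

module _ {n : ℕ} (G : Graph n) where

  adjacency : Fin n → Fin n → ℕ
  adjacency u v = indicator (adj? G u v)

  degree : Fin n → ℕ
  degree v = ∑ⱽ (adjacency v)

  adjacency-sym : ∀ u v → adjacency u v ≡ adjacency v u
  adjacency-sym u v with adj? G u v | adj? G v u
  ... | yes _ | yes _ = refl
  ... | no  _ | no  _ = refl
  ... | yes a | no ¬a = contradiction (symm G a) ¬a
  ... | no ¬a | yes a = contradiction (symm G a) ¬a

  adjacency-irrefl : ∀ v → adjacency v v ≡ 0
  adjacency-irrefl v with adj? G v v
  ... | yes a = contradiction a (irrefl G refl)
  ... | no  _ = refl

  handshake : ∃[ h ] ∑ⱽ degree ≡ h + h
  handshake = ∑-symmetric-even adjacency adjacency-irrefl adjacency-sym (allFin n)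

  length-neighbours : ∀ v → length (vertices (adj? G v)) ≡ degree v
  length-neighbours v = length-vertices (adj? G v)

module _ {n : ℕ} {G H : Graph n} (comp : Complementary G H) where

  degree-complement : ∀ v → degree G v + degree H v + 1 ≡ n
  degree-complement v = begin
    degree G v + degree H v + 1
      ≡⟨ cong₂ _+_ (∑-+ (allFin n) (adjacency G v) (adjacency H v)) (∑-≟ v) ⟨
    ∑ⱽ (λ w → adjacency G v w + adjacency H v w) + ∑ⱽ (λ w → indicator (v Fin.≟ w))
      ≡⟨ ∑-+ (allFin n) (λ w → adjacency G v w + adjacency H v w) (λ w → indicator (v Fin.≟ w)) ⟨
    ∑ⱽ (λ w → adjacency G v w + adjacency H v w + indicator (v Fin.≟ w))
      ≡⟨ ∑-cong (allFin n) exactly-one ⟩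
    ∑ⱽ {n} (λ _ → 1)
      ≡⟨ ∑ⱽ-const {n} 1 ⟩
    n * 1
      ≡⟨ ℕ.*-identityʳ n ⟩
    n ∎
    where
    open ≡-Reasoning
    exactly-one : ∀ w → adjacency G v w + adjacency H v w + indicator (v Fin.≟ w) ≡ 1
    exactly-one w with adj? G v w | adj? H v w | v Fin.≟ w
    ... | yes g | yes h | _        = contradiction h (disjoint comp g)
    ... | yes g | _     | yes refl = contradiction g (irrefl G refl)
    ... | _     | yes h | yes refl = contradiction h (irrefl H refl)
    ... | yes _ | no  _ | no  _    = refl
    ... | no  _ | yes _ | no  _    = refl
    ... | no  _ | no  _ | yes _    = refl
    ... | no ¬g | no ¬h | no v≢w   = contradiction (cover comp v≢w ¬g) ¬h

  near-or-complement : ∀ v w → Near G v w ⊎ Adj H v w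
  near-or-complement v w with near? G v w
  ... | yes nr = inj₁ nr
  ... | no ¬nr = inj₂ (cover comp (¬nr ∘ inj₁) (¬nr ∘ inj₂))

  -- A vertex that neither `u` nor `v` dominates in `H` is adjacent to both in `G`; without such a
  -- vertex, `u` and `v` alone would dominate `H`.
  commonNeighbours : ∀ {b} → IsγP H b → 3 ≤ b → HasCommonNeighbours G
  commonNeighbours (_ , minimal) 3≤b u v with Fin.any? (λ w → adj? G w u ×-dec adj? G w v)
  ... | yes found = found
  ... | no  none  = contradiction
    (ℕ.≤-trans 3≤b (minimal (u ∷ v ∷ []) (dominating⇒observing dominating))) ℕ.1+n≰n
    where
    dominating : Dominating H (_∈ u ∷ v ∷ [])
    dominating w with near? H u w | near? H v w
    ... | yes uw | _      = u , here refl , uw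
    ... | no  _  | yes vw = v , there (here refl) , vw
    ... | no ¬uw | no ¬vw = contradiction (w , joined ¬uw , joined ¬vw) none
      where
      joined : ∀ {x} → ¬ Near H x w → Adj G w x
      joined ¬xw = symm G (cover (complementary-sym comp) (¬xw ∘ inj₁) (¬xw ∘ inj₂))

module _ {n : ℕ} {G : Graph n} (common : HasCommonNeighbours G) where

  -- The neighbours of `v` dominate, since every vertex has a common neighbour with `v`.
  γP≤degree : ∀ {a} → IsγP G a → ∀ v → a ≤ degree G v
  γP≤degree (_ , minimal) v = ℕ.≤-trans
    (minimal (vertices (adj? G v)) (dominating⇒observing λ w →
      let x , xv , xw = common v w
      in  x , ∈-vertices (adj? G v) (symm G xv) , inj₂ xw))
    (ℕ.≤-reflexive (length-neighbours G v))

  last-observed : ∀ {S} y → (∀ w → w ≢ y → Observed G S w) → Observing G S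
  last-observed y rest w with w Fin.≟ y
  ... | no  w≢y  = rest w w≢y
  ... | yes refl = let z , zy , _ = common y y in
    force (rest z λ z≡y → irrefl G z≡y zy) zy λ _ u≢y → rest _ u≢y

  -- Each added centre disposes of two vertices of `ys`. The bound is odd because a single leftover
  -- vertex is forced by any of its neighbours.
  complete-observation : ∀ m xs ys →
    (∀ w → (∃[ v ] v ∈ xs × Near G v w) ⊎ w ∈ ys) → length ys ≤ suc (m + m) →
    ∃[ zs ] Observing G (_∈ zs) × length zs ≤ length xs + m
  complete-observation m xs [] covered _ =
    xs , dominating⇒observing (λ w → Sum.[ (λ d → d) , (λ ()) ] (covered w)) , ℕ.m≤m+n _ m
  complete-observation m xs (y ∷ []) covered _ =
    xs , last-observed y rest , ℕ.m≤m+n _ m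
    where
    rest : ∀ w → w ≢ y → Observed G (_∈ xs) w
    rest w w≢y with covered w
    ... | inj₁ (v , v∈ , vw) = near v∈ vw
    ... | inj₂ (here eq)     = contradiction eq w≢y
  complete-observation zero    xs (_ ∷ _ ∷ _) covered (s≤s ())
  complete-observation (suc m) xs (y₁ ∷ y₂ ∷ ys) covered (s≤s le) =
    let w , w₁ , w₂ = common y₁ y₂
        zs , obs , le′ = complete-observation m (w ∷ xs) ys (covered′ w₁ w₂)
          (ℕ.≤-pred (ℕ.≤-trans le (ℕ.≤-reflexive (cong suc (ℕ.+-suc m m)))))
    in  zs , obs , ℕ.≤-trans le′ (ℕ.≤-reflexive (sym (ℕ.+-suc _ m)))
    where
    covered′ : ∀ {x} → Adj G x y₁ → Adj G x y₂ → ∀ w →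
               (∃[ v ] v ∈ x ∷ xs × Near G v w) ⊎ w ∈ ys
    covered′ x₁ x₂ w with covered w
    ... | inj₁ (v , v∈ , vw)        = inj₁ (v , there v∈ , vw)
    ... | inj₂ (here refl)          = inj₁ (_ , here refl , inj₂ x₁)
    ... | inj₂ (there (here refl))  = inj₁ (_ , here refl , inj₂ x₂)
    ... | inj₂ (there (there w∈))   = inj₂ w∈

  -- A common neighbour w of x₀ and x₁ that does not also take care of x₂
  -- distinguishes x₀ from x₂, so a common neighbour w′ of x₁ and x₃ suffices:
  -- w then forces x₀, and x₂ is the last vertex.
  four-undominated : ∀ {v x₀ x₁ x₂ x₃} →
    (∀ w → Near G v w ⊎ w ∈ x₀ ∷ x₁ ∷ x₂ ∷ x₃ ∷ []) →
    ∃[ z ] Observing G (_∈ v ∷ z ∷ [])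
  four-undominated {v} {x₀} {x₁} {x₂} {x₃} covered
    with common x₀ x₁ | common x₁ x₃
  ... | w , w₀ , w₁ | w′ , w′₁ , w′₃ with near? G w x₂
  ...   | yes w₂ = w , last-observed x₃ rest
    where
    rest : ∀ u → u ≢ x₃ → Observed G (_∈ v ∷ w ∷ []) u
    rest u u≢x₃ with covered u
    ... | inj₁ nr                                  = near (here refl) nr
    ... | inj₂ (here refl)                         = near (there (here refl)) (inj₂ w₀)
    ... | inj₂ (there (here refl))                 = near (there (here refl)) (inj₂ w₁)
    ... | inj₂ (there (there (here refl)))         = near (there (here refl)) w₂
    ... | inj₂ (there (there (there (here eq))))   = contradiction eq u≢x₃
  ...   | no ¬w₂ = w′ , last-observed x₂ rest
    where
    Obs : Pred (Fin n) 0ℓ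
    Obs = Observed G (_∈ v ∷ w′ ∷ [])

    most : ∀ u → u ≢ x₀ → u ≢ x₂ → Obs u
    most u u≢x₀ u≢x₂ with covered u
    ... | inj₁ nr                                  = near (here refl) nr
    ... | inj₂ (here eq)                           = contradiction eq u≢x₀
    ... | inj₂ (there (here refl))                 = near (there (here refl)) (inj₂ w′₁)
    ... | inj₂ (there (there (here eq)))           = contradiction eq u≢x₂
    ... | inj₂ (there (there (there (here refl)))) = near (there (here refl)) (inj₂ w′₃)

    rest : ∀ u → u ≢ x₂ → Obs u
    rest u u≢x₂ with u Fin.≟ x₀
    ... | no  u≢x₀ = most u u≢x₀ u≢x₂
    ... | yes refl = force
      (most w (λ { refl → irrefl G refl w₀ }) (¬w₂ ∘ inj₁)) w₀
      λ {y} wy y≢x₀ → most y y≢x₀ λ { refl → ¬w₂ (inj₂ wy) }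

module _ {n : ℕ} {G H : Graph n} (comp : Complementary G H) (common : HasCommonNeighbours G) where

  -- Pairing disposes of three undominated vertices with one further centre; the fourth needs
  -- `four-undominated`.
  codegree≤4⇒γP≤2 : ∀ {a} → IsγP G a → ∀ v → degree H v ≤ 4 → a ≤ 2
  codegree≤4⇒γP≤2 {a} (_ , minimal) v small =
    go (vertices (adj? H v)) covered (ℕ.≤-trans (ℕ.≤-reflexive (length-neighbours H v)) small)
    where
    covered : ∀ w → Near G v w ⊎ w ∈ vertices (adj? H v)
    covered w = Sum.map₂ (∈-vertices (adj? H v)) (near-or-complement comp v w)

    few : ∀ ys → (∀ w → Near G v w ⊎ w ∈ ys) → length ys ≤ 3 → a ≤ 2
    few ys cov le =
      let zs , obs , le′ = complete-observation common 1 (v ∷ []) ys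
            (λ w → Sum.map₁ (λ nr → v , here refl , nr) (cov w)) le
      in  ℕ.≤-trans (minimal zs obs) le′

    go : ∀ ys → (∀ w → Near G v w ⊎ w ∈ ys) → length ys ≤ 4 → a ≤ 2
    go ys@[]                  cov _ = few ys cov z≤n
    go ys@(_ ∷ [])            cov _ = few ys cov (s≤s z≤n)
    go ys@(_ ∷ _ ∷ [])        cov _ = few ys cov (s≤s (s≤s z≤n))
    go ys@(_ ∷ _ ∷ _ ∷ [])    cov _ = few ys cov (s≤s (s≤s (s≤s z≤n)))
    go (_ ∷ _ ∷ _ ∷ _ ∷ [])   cov _ = let _ , obs = four-undominated common cov in minimal _ obs
    go (_ ∷ _ ∷ _ ∷ _ ∷ _ ∷ _) cov (s≤s (s≤s (s≤s (s≤s ()))))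

  codegree : Fin n → Fin n → ℕ
  codegree v w = ∑ⱽ λ u → indicator (adj? H v u ×-dec adj? H w u)

  codegree-self : ∀ v → codegree v v ≡ degree H v
  codegree-self v = ∑-cong (allFin n) λ u → trans (indicator-× (adj? H v u) (adj? H v u)) (idem (adj? H v u))
    where
    idem : {P : Set} (p? : Dec P) → indicator p? * indicator p? ≡ indicator p?
    idem (yes _) = refl
    idem (no  _) = refl

  -- The sum counts the walks of length two in `H` that start at `v`; they are recounted by their
  -- middle vertex.
  ∑-codegree : ∀ {d} → (∀ u → degree H u ≤ d) → ∀ v → ∑ⱽ (codegree v) ≤ degree H v * d
  ∑-codegree {d} bound v = begin
    ∑ⱽ (codegree v)
      ≡⟨ ∑-swap (allFin n) (allFin n) (λ w u → indicator (adj? H v u ×-dec adj? H w u)) ⟩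
    ∑ⱽ (λ u → ∑ⱽ λ w → indicator (adj? H v u ×-dec adj? H w u))
      ≡⟨ ∑-cong (allFin n) (λ u → trans
           (∑-cong (allFin n) λ w → trans (indicator-× (adj? H v u) (adj? H w u))
             (cong (adjacency H v u *_) (adjacency-sym H w u)))
           (∑-*ˡ (allFin n) (adjacency H v u) (adjacency H u))) ⟩
    ∑ⱽ (λ u → adjacency H v u * degree H u)
      ≤⟨ ∑-mono (allFin n) (λ u → ℕ.*-monoʳ-≤ (adjacency H v u) (bound u)) ⟩
    ∑ⱽ (λ u → adjacency H v u * d)
      ≡⟨ ∑-*ʳ (allFin n) d (adjacency H v) ⟩
    degree H v * d ∎
    where open ℕ.≤-Reasoning

  -- The codegree of v and w in H counts the vertices that v and w together do
  -- not dominate in G.  Were it large for all w ≠ v, its sum over w would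
  -- exceed the bound ∑-codegree.
  small-codegree : ∀ {d t} → (∀ u → degree H u ≤ d) → ∀ v →
                   n * t + degree H v > degree H v * d + t → ∃[ w ] codegree v w < t
  small-codegree {d} {t} bound v large with Fin.any? (λ w → codegree v w ℕ.<? t)
  ... | yes found = found
  ... | no  none  = contradiction large (ℕ.≤⇒≯ (begin
    n * t + degree H v
      ≡⟨ cong₂ _+_ (∑ⱽ-const {n} t) (ℕ.*-identityˡ (degree H v)) ⟨
    ∑ⱽ {n} (λ _ → t) + 1 * degree H v
      ≡⟨ cong (λ e → ∑ⱽ {n} (λ _ → t) + e * degree H v) (∑-≟ v) ⟨
    ∑ⱽ {n} (λ _ → t) + ∑ⱽ (λ w → indicator (v Fin.≟ w)) * degree H v
      ≡⟨ cong (∑ⱽ {n} (λ _ → t) +_) (∑-*ʳ (allFin n) (degree H v) (λ w → indicator (v Fin.≟ w))) ⟨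
    ∑ⱽ {n} (λ _ → t) + ∑ⱽ (λ w → indicator (v Fin.≟ w) * degree H v)
      ≡⟨ ∑-+ (allFin n) (λ _ → t) (λ w → indicator (v Fin.≟ w) * degree H v) ⟨
    ∑ⱽ (λ w → t + indicator (v Fin.≟ w) * degree H v)
      ≤⟨ ∑-mono (allFin n) pointwise ⟩
    ∑ⱽ (λ w → codegree v w + indicator (v Fin.≟ w) * t)
      ≡⟨ ∑-+ (allFin n) (codegree v) (λ w → indicator (v Fin.≟ w) * t) ⟩
    ∑ⱽ (codegree v) + ∑ⱽ (λ w → indicator (v Fin.≟ w) * t)
      ≡⟨ cong (∑ⱽ (codegree v) +_) (∑-*ʳ (allFin n) t (λ w → indicator (v Fin.≟ w))) ⟩
    ∑ⱽ (codegree v) + ∑ⱽ (λ w → indicator (v Fin.≟ w)) * t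
      ≡⟨ cong (λ e → ∑ⱽ (codegree v) + e * t) (∑-≟ v) ⟩
    ∑ⱽ (codegree v) + 1 * t
      ≡⟨ cong (∑ⱽ (codegree v) +_) (ℕ.*-identityˡ t) ⟩
    ∑ⱽ (codegree v) + t
      ≤⟨ ℕ.+-monoˡ-≤ t (∑-codegree bound v) ⟩
    degree H v * d + t ∎))
    where
    open ℕ.≤-Reasoning
    -- At `w ≡ v` the codegree is known exactly: it is the degree of `v`. The indicator terms put it
    -- in place of `t` there without subtraction.
    pointwise : ∀ w → t + indicator (v Fin.≟ w) * degree H v ≤
                      codegree v w + indicator (v Fin.≟ w) * t
    pointwise w with v Fin.≟ w
    ... | no  _    = ℕ.+-monoˡ-≤ 0 (ℕ.≮⇒≥ (λ lt → none (w , lt)))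
    ... | yes refl = ℕ.≤-reflexive (trans (ℕ.+-comm t (1 * degree H v))
      (cong₂ _+_ (trans (ℕ.*-identityˡ (degree H v)) (sym (codegree-self v))) (sym (ℕ.*-identityˡ t))))

  -- If `v` and `w` left at most 2e + 1 vertices undominated, `e` further centres would do, 2 + e in
  -- all.
  codegree-bound : ∀ {e} → IsγP G (3 + e) → ∀ v w → 2 + (e + e) ≤ codegree v w
  codegree-bound {e} (_ , minimal) v w = ℕ.≮⇒≥ λ small →
    let both?  = λ u → adj? H v u ×-dec adj? H w u
        zs , obs , le = complete-observation common e (v ∷ w ∷ []) (vertices both?) covered
          (ℕ.≤-trans (ℕ.≤-reflexive (length-vertices both?)) (ℕ.≤-pred small))
    in  ℕ.1+n≰n (ℕ.≤-trans (minimal zs obs) le)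
    where
    covered : ∀ u → (∃[ x ] x ∈ v ∷ w ∷ [] × Near G x u) ⊎
                    u ∈ vertices (λ u → adj? H v u ×-dec adj? H w u)
    covered u with near-or-complement comp v u | near-or-complement comp w u
    ... | inj₁ nr | _       = inj₁ (v , here refl , nr)
    ... | inj₂ _  | inj₁ nr = inj₁ (w , there (here refl) , nr)
    ... | inj₂ vu | inj₂ wu = inj₂ (∈-vertices (λ u → adj? H v u ×-dec adj? H w u) (vu , wu))

-- Orders that would violate the bound

exceptional : ∀ n {_ : True (n ∈? exceptionalOrders)} → ¬ (n ∉ exceptionalOrders)
exceptional n {listed} n∉ = n∉ (toWitness listed)

adjacent₀₁ : {G : Graph 2} → Connected G → Adj G Fin.zero (Fin.suc Fin.zero)
adjacent₀₁ {G} conn = decidable-stable (adj? G _ _) λ ¬a →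
  contradiction (connected-closure {G = G} conn {_≡ Fin.zero} (closed ¬a) {Fin.zero} {Fin.suc Fin.zero} refl) λ ()
  where
  closed : ¬ Adj G Fin.zero (Fin.suc Fin.zero) → ∀ {u v} → u ≡ Fin.zero → Adj G u v → v ≡ Fin.zero
  closed ¬a {v = Fin.zero}         refl _ = refl
  closed ¬a {v = Fin.suc Fin.zero} refl a = contradiction a ¬a

private
  odd≢even : ∀ h → 55 ≢ h + h
  odd≢even h eq = from-no (2 ∣? 55) (subst (2 ∣_) (trans (cong (h +_) (ℕ.+-identityʳ h)) (sym eq)) (m∣m*n h))

module _ {n : ℕ} {G H : Graph n} (comp : Complementary G H) where

  -- All degrees in both graphs must be at least 5. They add up to n - 1 ≤ 10 at each vertex, so n =
  -- 11 and `G` is 5-regular, with the odd degree sum 55.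
  small-orders : IsγP G 3 → IsγP H 3 → n ≤ 11 → Fin n → Empty
  small-orders γG γH n≤11 v₀ with Fin.any? (λ v → (degree H v ℕ.≤? 4) ⊎-dec (degree G v ℕ.≤? 4))
  ... | yes (v , inj₁ le) = from-no (3 ℕ.≤? 2)
    (codegree≤4⇒γP≤2 comp (commonNeighbours comp γH ℕ.≤-refl) γG v le)
  ... | yes (v , inj₂ le) = from-no (3 ℕ.≤? 2)
    (codegree≤4⇒γP≤2 (complementary-sym comp)
      (commonNeighbours (complementary-sym comp) γG ℕ.≤-refl) γH v le)
  ... | no  none = odd≢even (proj₁ (handshake G)) (begin
    55                   ≡⟨ cong (_* 5) (sym (n≡11 v₀)) ⟩
    n * 5                ≡⟨ ∑ⱽ-const {n} 5 ⟨
    ∑ⱽ {n} (λ _ → 5)     ≡⟨ ∑-cong (allFin n) (λ v → sym (degree≡5 v)) ⟩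
    ∑ⱽ (degree G)        ≡⟨ proj₂ (handshake G) ⟩
    proj₁ (handshake G) + proj₁ (handshake G) ∎)
    where
    open ≡-Reasoning

    5≤G : ∀ v → 5 ≤ degree G v
    5≤G v = ℕ.≰⇒> (λ le → none (v , inj₂ le))

    5≤H : ∀ v → 5 ≤ degree H v
    5≤H v = ℕ.≰⇒> (λ le → none (v , inj₁ le))

    n≡11 : Fin n → n ≡ 11
    n≡11 v = ℕ.≤-antisym n≤11 (ℕ.≤-trans
      (ℕ.+-monoˡ-≤ 1 (ℕ.+-mono-≤ (5≤G v) (5≤H v))) (ℕ.≤-reflexive (degree-complement comp v)))

    degree≡5 : ∀ v → degree G v ≡ 5
    degree≡5 v = ℕ.≤-antisym
      (ℕ.+-cancelʳ-≤ 6 (degree G v) 5 (ℕ.≤-trans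
        (ℕ.≤-trans (ℕ.+-monoʳ-≤ (degree G v) (ℕ.+-monoˡ-≤ 1 (5≤H v)))
                   (ℕ.≤-reflexive (sym (ℕ.+-assoc (degree G v) (degree H v) 1))))
        (ℕ.≤-trans (ℕ.≤-reflexive (degree-complement comp v)) n≤11)))
      (5≤G v)

  -- With a = 3 + e, the number d + 1 is n - 1 - a and bounds the degrees of `H`. Every codegree is
  -- at least t = 2(a - 2), and the walks of length two from `v₀` then give (n - 1)t ≤ (d + 1)d.
  greedy : ∀ {e d} → IsγP G (3 + e) → IsγP H 3 → Fin n → n ≡ suc d + suc (3 + e) →
           (suc d + (3 + e)) * (2 + (e + e)) ≤ suc d * d
  greedy {e} {d} γG γH v₀ n≡ = ℕ.≮⇒≥ λ lt →
    let w , small = small-codegree comp common {suc d} {t} codegree≤ v₀ (large lt)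
    in  ℕ.<⇒≱ small (codegree-bound comp common γG v₀ w)
    where
    common = commonNeighbours comp γH ℕ.≤-refl
    t = 2 + (e + e)
    u = degree H v₀

    codegree≤ : ∀ v → degree H v ≤ suc d
    codegree≤ v = ℕ.+-cancelˡ-≤ (3 + e) _ _ (ℕ.+-cancelʳ-≤ 1 _ _ (begin
      3 + e + degree H v + 1        ≤⟨ ℕ.+-monoˡ-≤ 1 (ℕ.+-monoˡ-≤ (degree H v) (γP≤degree common γG v)) ⟩
      degree G v + degree H v + 1   ≡⟨ degree-complement comp v ⟩
      n                             ≡⟨ n≡ ⟩
      suc d + suc (3 + e)           ≡⟨ shuffle e d ⟩
      3 + e + suc d + 1             ∎))
      where
      open ℕ.≤-Reasoning
      shuffle : ∀ e d → suc d + suc (3 + e) ≡ 3 + e + suc d + 1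
      shuffle = solve-∀

    large : suc d * d < (suc d + (3 + e)) * t → n * t + u > u * suc d + t
    large lt = begin-strict
      u * suc d + t                      ≡⟨ cong (_+ t) (ℕ.*-suc u d) ⟩
      u + u * d + t                      ≤⟨ ℕ.+-monoˡ-≤ t (ℕ.+-monoʳ-≤ u (ℕ.*-monoˡ-≤ d (codegree≤ v₀))) ⟩
      u + suc d * d + t                  <⟨ ℕ.+-monoˡ-< t (ℕ.+-monoʳ-< u lt) ⟩
      u + (suc d + (3 + e)) * t + t      ≡⟨ rearrange u (suc d + (3 + e)) t ⟩
      suc (suc d + (3 + e)) * t + u      ≡⟨ cong (λ k → k * t + u) (trans (sym (ℕ.+-suc (suc d) (3 + e))) (sym n≡)) ⟩
      n * t + u                          ∎
      where
      open ℕ.≤-Reasoning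
      rearrange : ∀ u k t → u + k * t + t ≡ suc k * t + u
      rearrange = solve-∀

  -- From a = 8 on, `greedy` is contradictory for every `r ≤ 3`; the identities below exhibit the
  -- surplus. For a = 7 it still fails at `r` = 3, that is, at n = 24. Below that, it is needed only
  -- for the unlisted orders 19, 22 and 23.
  near-extremal : ∀ e r → r ≤ 3 → n ≡ (3 + e) * 3 + r → n ∉ exceptionalOrders → Fin n →
          IsγP G (3 + e) → IsγP H 3 → Empty
  near-extremal 0 0 _ refl n∉ v γG γH = small-orders γG γH (ℕ.m≤m+n 9 2) v
  near-extremal 0 1 _ refl n∉ v γG γH = small-orders γG γH (ℕ.m≤m+n 10 1) v
  near-extremal 0 2 _ refl n∉ v γG γH = small-orders γG γH ℕ.≤-refl v
  near-extremal 0 3 _ refl n∉ v γG γH = exceptional 12 n∉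
  near-extremal 1 0 _ refl n∉ v γG γH = exceptional 12 n∉
  near-extremal 1 1 _ refl n∉ v γG γH = exceptional 13 n∉
  near-extremal 1 2 _ refl n∉ v γG γH = exceptional 14 n∉
  near-extremal 1 3 _ refl n∉ v γG γH = exceptional 15 n∉
  near-extremal 2 0 _ refl n∉ v γG γH = exceptional 15 n∉
  near-extremal 2 1 _ refl n∉ v γG γH = exceptional 16 n∉
  near-extremal 2 2 _ refl n∉ v γG γH = exceptional 17 n∉
  near-extremal 2 3 _ refl n∉ v γG γH = exceptional 18 n∉
  near-extremal 3 0 _ refl n∉ v γG γH = exceptional 18 n∉
  near-extremal 3 1 _ refl n∉ v γG γH = from-no (144 ℕ.≤? 132) (greedy {3} {11} γG γH v refl)
  near-extremal 3 2 _ refl n∉ v γG γH = exceptional 20 n∉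
  near-extremal 3 3 _ refl n∉ v γG γH = exceptional 21 n∉
  near-extremal 4 0 _ refl n∉ v γG γH = exceptional 21 n∉
  near-extremal 4 1 _ refl n∉ v γG γH = from-no (210 ℕ.≤? 182) (greedy {4} {13} γG γH v refl)
  near-extremal 4 2 _ refl n∉ v γG γH = from-no (220 ℕ.≤? 210) (greedy {4} {14} γG γH v refl)
  near-extremal 4 3 _ refl n∉ v γG γH = exceptional 24 n∉
  near-extremal (suc (suc (suc (suc (suc f))))) r r≤3 n≡ n∉ v γG γH =
    ℕ.<⇒≱ (large r r≤3) (greedy {5 + f} {14 + (f + f) + r} γG γH v (trans n≡ (order f r)))
    where
    order : ∀ f r → (8 + f) * 3 + r ≡ suc (14 + (f + f) + r) + suc (8 + f)
    order = solve-∀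

    identity₀ : ∀ f → (suc (14 + (f + f) + 0) + (8 + f)) * (2 + ((5 + f) + (5 + f))) ≡
                suc (suc (14 + (f + f) + 0) * (14 + (f + f) + 0) + (65 + 24 * f + 2 * f * f))
    identity₀ = solve-∀
    identity₁ : ∀ f → (suc (14 + (f + f) + 1) + (8 + f)) * (2 + ((5 + f) + (5 + f))) ≡
                suc (suc (14 + (f + f) + 1) * (14 + (f + f) + 1) + (47 + 22 * f + 2 * f * f))
    identity₁ = solve-∀
    identity₂ : ∀ f → (suc (14 + (f + f) + 2) + (8 + f)) * (2 + ((5 + f) + (5 + f))) ≡
                suc (suc (14 + (f + f) + 2) * (14 + (f + f) + 2) + (27 + 20 * f + 2 * f * f))
    identity₂ = solve-∀
    identity₃ : ∀ f → (suc (14 + (f + f) + 3) + (8 + f)) * (2 + ((5 + f) + (5 + f))) ≡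
                suc (suc (14 + (f + f) + 3) * (14 + (f + f) + 3) + (5 + 18 * f + 2 * f * f))
    identity₃ = solve-∀

    exceeds : ∀ {x y} z → x ≡ suc (y + z) → y < x
    exceeds z refl = s≤s (ℕ.m≤m+n _ z)

    large : ∀ r → r ≤ 3 → suc (14 + (f + f) + r) * (14 + (f + f) + r) <
            (suc (14 + (f + f) + r) + (8 + f)) * (2 + ((5 + f) + (5 + f)))
    large 0 _ = exceeds _ (identity₀ f)
    large 1 _ = exceeds _ (identity₁ f)
    large 2 _ = exceeds _ (identity₂ f)
    large 3 _ = exceeds _ (identity₃ f)
    large (suc (suc (suc (suc _)))) (s≤s (s≤s (s≤s ())))
  near-extremal 0 (suc (suc (suc (suc _)))) (s≤s (s≤s (s≤s ())))
  near-extremal 1 (suc (suc (suc (suc _)))) (s≤s (s≤s (s≤s ())))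
  near-extremal 2 (suc (suc (suc (suc _)))) (s≤s (s≤s (s≤s ())))
  near-extremal 3 (suc (suc (suc (suc _)))) (s≤s (s≤s (s≤s ())))
  near-extremal 4 (suc (suc (suc (suc _)))) (s≤s (s≤s (s≤s ())))

private
  between : ∀ {n} m r → m ≤ n → n ≤ m + r → ∃[ s ] s ≤ r × n ≡ m + s
  between m r m≤n n≤ with ℕ.m≤n⇒∃[o]m+o≡n m≤n
  ... | s , refl = s , ℕ.+-cancelˡ-≤ m s r n≤ , refl

  sixteen : ∀ {n} s → s ≤ 2 → n ≡ 16 + s → ¬ (n ∉ exceptionalOrders)
  sixteen 0 _ refl = exceptional 16
  sixteen 1 _ refl = exceptional 17
  sixteen 2 _ refl = exceptional 18
  sixteen (suc (suc (suc _))) (s≤s (s≤s ()))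

  twenty : ∀ {n} s → s ≤ 1 → n ≡ 20 + s → ¬ (n ∉ exceptionalOrders)
  twenty 0 _ refl = exceptional 20
  twenty 1 _ refl = exceptional 21
  twenty (suc (suc _)) (s≤s ())

-- For a = 4 + p and b = 4 + q the two bounds combine to (1 + p)(1 + q) ≤ 3. Up to symmetry this
-- leaves (4, 4) with n from 16 to 18, (4, 5) with 20 or 21, and (4, 6) with 24.
both≥4 : ∀ {n} p q → (4 + p) * (4 + q) ≤ n → n ≤ (6 + p + q) * 3 → ¬ (n ∉ exceptionalOrders)
both≥4 {n} p q lower upper n∉ = go p q
  (ℕ.+-cancelˡ-≤ (16 + 3 * p + 3 * q) _ _ (begin
    16 + 3 * p + 3 * q + (p + q + p * q)   ≡⟨ product p q ⟨
    (4 + p) * (4 + q)                      ≤⟨ lower ⟩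
    n                                      ≤⟨ upper ⟩
    (6 + p + q) * 3                        ≡⟨ bound p q ⟩
    16 + 3 * p + 3 * q + 2                 ∎)) lower upper
  where
  open ℕ.≤-Reasoning

  product : ∀ p q → (4 + p) * (4 + q) ≡ 16 + 3 * p + 3 * q + (p + q + p * q)
  product = solve-∀

  bound : ∀ p q → (6 + p + q) * 3 ≡ 16 + 3 * p + 3 * q + 2
  bound = solve-∀

  go : ∀ p q → p + q + p * q ≤ 2 → (4 + p) * (4 + q) ≤ n → n ≤ (6 + p + q) * 3 → Empty
  go 0 0 _ l u = let s , s≤2 , eq = between 16 2 l u in sixteen s s≤2 eq n∉
  go 0 1 _ l u = let s , s≤1 , eq = between 20 1 l u in twenty s s≤1 eq n∉
  go 1 0 _ l u = let s , s≤1 , eq = between 20 1 l u in twenty s s≤1 eq n∉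
  go 0 2 _ l u = exceptional 24 (subst (_∉ exceptionalOrders) (ℕ.≤-antisym u l) n∉)
  go 2 0 _ l u = exceptional 24 (subst (_∉ exceptionalOrders) (ℕ.≤-antisym u l) n∉)
  go 0 (suc (suc (suc _))) (s≤s (s≤s ()))
  go (suc (suc (suc _))) 0 (s≤s (s≤s ()))
  go (suc p) (suc q) le _ _ = from-no (3 ℕ.≤? 2)
    (ℕ.≤-trans (s≤s (subst (2 ≤_) (sym (expand p q)) (ℕ.m≤m+n 2 _))) le)
    where
    expand : ∀ p q → p + suc q + (suc p) * suc q ≡ 2 + (p + q + p + q + p * q)
    expand = solve-∀

module _ {n : ℕ} {G H : Graph n} (comp : Complementary G H)
         (connG : Connected G) (connH : Connected H) (3≤n : 3 ≤ n) where

  two-impossible : ∀ {a} → IsγP G (2 + a) → IsγP H 2 → n ≤ (2 + a) * 3 → Empty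
  two-impossible γG γH n≤ = from-no (2 ℕ.≤? 1)
    (extremal⇒complement≤1 {G = G} {H} comp connG connH 3≤n γG (s≤s (s≤s z≤n))
      (ℕ.≤-antisym n≤ (γP*3≤n {G = G} connG 3≤n γG)) γH)

  three-impossible : ∀ {e} → n ∉ exceptionalOrders → Fin n →
                     IsγP G (3 + e) → IsγP H 3 → n ≤ (4 + e) * 3 → Empty
  three-impossible {e} n∉ v γG γH n≤ =
    let r , r≤3 , n≡ = between ((3 + e) * 3) 3 (γP*3≤n {G = G} connG 3≤n γG)
                         (ℕ.≤-trans n≤ (ℕ.≤-reflexive (ℕ.+-comm 3 ((3 + e) * 3))))
    in  near-extremal comp e r r≤3 n≡ n∉ v γG γH

private
  module _ {n : ℕ} {G H : Graph n} (comp : Complementary G H)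
           (connG : Connected G) (connH : Connected H) (n∉ : n ∉ exceptionalOrders) where

    vertex : ∀ {n} → 3 ≤ n → Fin n
    vertex (s≤s _) = Fin.zero

    -- Here `a` and `b` are one less than the power domination numbers, so the last inequality is
    -- the negation of the bound, freed from the ceiling.
    large-order : 3 ≤ n → ∀ a b → IsγP G (suc a) → IsγP H (suc b) → ¬ (n ≤ (a + b) * 3)
    large-order 3≤n a 0 γG _ n≤ = ℕ.<⇒≱
      (ℕ.≤-trans (ℕ.m≤n+m _ 2) (γP*3≤n {G = G} connG 3≤n γG))
      (subst (λ k → n ≤ k * 3) (ℕ.+-identityʳ a) n≤)
    large-order 3≤n 0 (suc b) _ γH n≤ = ℕ.<⇒≱ (ℕ.≤-trans (ℕ.m≤n+m _ 2) (γP*3≤n {G = H} connH 3≤n γH)) n≤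
    large-order 3≤n (suc a) 1 γG γH n≤ = two-impossible comp connG connH 3≤n γG γH
      (subst (λ k → n ≤ suc k * 3) (ℕ.+-comm a 1) n≤)
    large-order 3≤n 1 (suc b) γG γH n≤ =
      two-impossible (complementary-sym comp) connH connG 3≤n γH γG n≤
    large-order 3≤n (suc (suc a)) 2 γG γH n≤ = three-impossible comp connG connH 3≤n n∉ (vertex 3≤n) γG γH
      (subst (λ k → n ≤ suc (suc k) * 3) (ℕ.+-comm a 2) n≤)
    large-order 3≤n 2 (suc (suc b)) γG γH n≤ =
      three-impossible (complementary-sym comp) connH connG 3≤n n∉ (vertex 3≤n) γH γG n≤
    large-order 3≤n (suc (suc (suc a))) (suc (suc (suc b))) γG γH n≤ =
      both≥4 a b (isγP-product comp γG γH)
        (ℕ.≤-trans n≤ (ℕ.≤-reflexive (regroup a b))) n∉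
      where
      regroup : ∀ a b → (3 + a + (3 + b)) * 3 ≡ (6 + a + b) * 3
      regroup = solve-∀

-- Orders 1 and 2 are separate because 3a ≤ n fails for them: on one vertex both numbers are 1, and
-- on two vertices `G` and `H` cannot both be connected.
any-order : ∀ n {G H : Graph n} → Complementary G H → Connected G → Connected H →
            n ∉ exceptionalOrders →
            ∀ a b → IsγP G (suc a) → IsγP H (suc b) → ¬ (n ≤ (a + b) * 3)
any-order 0 {G} _ _ _ _ _ _ _ _ _ = ¬nonZero (nonempty G)
  where
  ¬nonZero : .(NonZero 0) → Empty
  ¬nonZero ()
any-order 1 {G} {H} _ _ _ _ a b γG γH n≤
  with isγP⇒≤ γG (λ v → v) (λ v → source (v , refl)) | isγP⇒≤ γH (λ v → v) (λ v → source (v , refl))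
... | s≤s z≤n | s≤s z≤n = from-no (1 ℕ.≤? 0) n≤
any-order 2 {G} {H} comp connG connH _ _ _ _ _ _ =
  disjoint comp (adjacent₀₁ {G} connG) (adjacent₀₁ {H} connH)
any-order (suc (suc (suc n))) comp connG connH n∉ =
  large-order comp connG connH n∉ (s≤s (s≤s (s≤s z≤n)))

sum-bound : (n : ℕ) (G : Graph n) → Connected G → Connected (complement G) →
            n ∉ exceptionalOrders → γP G + γP (complement G) ≤ ⌈ n /3⌉ + 1
sum-bound n G connG connH n∉ = bound (γP-isγP G) (γP-isγP (complement G))
  where
  bound : ∀ {a b} → IsγP G a → IsγP (complement G) b → a + b ≤ ⌈ n /3⌉ + 1
  bound γG γH with isγP⇒positive γG | isγP⇒positive γH
  ... | a , refl | b , refl = begin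
    suc a + suc b        ≡⟨ ℕ.+-suc (suc a) b ⟩
    2 + (a + b)          ≤⟨ s≤s (ℕ.≰⇒> λ le → any-order n (complement-complementary G) connG connH n∉ a b γG γH
                              (Equivalence.to (⌈n/3⌉≤k⇔n≤k*3 n (a + b)) le)) ⟩
    suc ⌈ n /3⌉          ≡⟨ ℕ.+-comm 1 ⌈ n /3⌉ ⟩
    ⌈ n /3⌉ + 1          ∎
    where open ℕ.≤-Reasoning

-- Coronas of complete graphs and sharpness

complete : ∀ m → Graph (suc m)
complete m = record
  { nonempty = _
  ; Adj      = _≢_
  ; adj?     = λ u v → ¬? (u Fin.≟ v)
  ; symm     = λ u≢v → u≢v ∘ sym
  ; irrefl   = λ u≡v u≢v → u≢v u≡v
  }

-- At least two vertices of `K` are required: a single one would be adjacent to both of its leaves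
-- and so isolated in the complement.
module Corona (m : ℕ) where

  private
    K : Graph (2 + m)
    K = complete (suc m)

    Vertex : Set
    Vertex = Fin (2 + m) × Part

    Edge : Rel Vertex 0ℓ
    Edge = Attached K ⊥

  edge? : Decidable Edge
  edge? (u , original) (v , original) with adj? K u v
  ... | yes a = yes (old a)
  ... | no ¬a = no λ { (old a) → ¬a a }
  edge? (u , original) (v , first) with u Fin.≟ v
  ... | yes refl = yes vv′
  ... | no  u≢v  = no λ { vv′ → u≢v refl }
  edge? (u , original) (v , second) with u Fin.≟ v
  ... | yes refl = yes vv″
  ... | no  u≢v  = no λ { vv″ → u≢v refl }
  edge? (u , first) (v , original) with u Fin.≟ v
  ... | yes refl = yes v′v
  ... | no  u≢v  = no λ { v′v → u≢v refl }
  edge? (u , second) (v , original) with u Fin.≟ v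
  ... | yes refl = yes v″v
  ... | no  u≢v  = no λ { v″v → u≢v refl }
  edge? (u , first)  (v , first)  = no λ ()
  edge? (u , second) (v , second) = no λ ()
  edge? (u , first)  (v , second) = no λ { (v′v″ v∈) → ∉⊥ v∈ }
  edge? (u , second) (v , first)  = no λ { (v″v′ v∈) → ∉⊥ v∈ }

  edge-sym : ∀ {x y} → Edge x y → Edge y x
  edge-sym (old a)   = old (symm K a)
  edge-sym vv′       = v′v
  edge-sym v′v       = vv′
  edge-sym vv″       = v″v
  edge-sym v″v       = vv″
  edge-sym (v′v″ v∈) = v″v′ v∈
  edge-sym (v″v′ v∈) = v′v″ v∈

  edge-irrefl : ∀ {x} → ¬ Edge x x
  edge-irrefl (old a) = irrefl K refl a

  private
    toPart : Fin 3 → Part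
    toPart Fin.zero                     = original
    toPart (Fin.suc Fin.zero)           = first
    toPart (Fin.suc (Fin.suc Fin.zero)) = second

    fromPart : Part → Fin 3
    fromPart original = Fin.zero
    fromPart first    = Fin.suc Fin.zero
    fromPart second   = Fin.suc (Fin.suc Fin.zero)

    toPart-fromPart : ∀ p → toPart (fromPart p) ≡ p
    toPart-fromPart original = refl
    toPart-fromPart first    = refl
    toPart-fromPart second   = refl

    fromPart-toPart : ∀ r → fromPart (toPart r) ≡ r
    fromPart-toPart Fin.zero                     = refl
    fromPart-toPart (Fin.suc Fin.zero)           = refl
    fromPart-toPart (Fin.suc (Fin.suc Fin.zero)) = refl

  labelling : Fin ((2 + m) * 3) ↔ Vertex
  labelling = (↔-id _ ×-↔ mk↔ₛ′ toPart fromPart toPart-fromPart fromPart-toPart) ↔-∘ Fin.*↔×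

  open Inverse labelling using (to; from; strictlyInverseˡ; strictlyInverseʳ)

  corona : Graph ((2 + m) * 3)
  corona = record
    { nonempty = _
    ; Adj      = λ u v → Edge (to u) (to v)
    ; adj?     = λ u v → edge? (to u) (to v)
    ; symm     = edge-sym
    ; irrefl   = λ { refl → edge-irrefl }
    }

  private
    connected-by : (R : Rel Vertex 0ℓ) (S : Rel (Fin ((2 + m) * 3)) 0ℓ) →
                   (∀ {x y} → R x y → S (from x) (from y)) →
                   (∀ x y → Star R x y) → ∀ u v → Star S u v
    connected-by R S R⇒S conn u v =
      subst₂ (Star S) (strictlyInverseʳ u) (strictlyInverseʳ v)
        (Star.gmap from R⇒S (conn (to u) (to v)))

    from-edge : ∀ {x y} → Edge x y → Adj corona (from x) (from y)
    from-edge {x} {y} = subst₂ Edge (sym (strictlyInverseˡ x)) (sym (strictlyInverseˡ y))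

    Apart : Rel Vertex 0ℓ
    Apart x y = x ≢ y × ¬ Edge x y

    apart-sym : ∀ {x y} → Apart x y → Apart y x
    apart-sym (x≢y , ¬e) = x≢y ∘ sym , ¬e ∘ edge-sym

    from-apart : ∀ {x y} → Apart x y → Adj (complement corona) (from x) (from y)
    from-apart {x} {y} (x≢y , ¬e) =
      (λ eq → x≢y (trans (sym (strictlyInverseˡ x)) (trans (cong to eq) (strictlyInverseˡ y)))) ,
      ¬e ∘ subst₂ Edge (strictlyInverseˡ x) (strictlyInverseˡ y)

    toCentre : ∀ x → Star Edge x (proj₁ x , original)
    toCentre (v , original) = ε
    toCentre (v , first)    = v′v ◅ ε
    toCentre (v , second)   = v″v ◅ ε

    centres : ∀ u v → Star Edge (u , original) (v , original)
    centres u v with u Fin.≟ v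
    ... | yes refl = ε
    ... | no  u≢v  = old u≢v ◅ ε

    -- The leaves `(v , first)` are pairwise adjacent in the complement, so it is enough to reach
    -- one of them from every vertex; an original vertex goes to a leaf of another one.
    toLeaf : ∀ x → ∃[ v ] Star Apart x (v , first)
    toLeaf (v , original) = punchIn v Fin.zero ,
      ((λ ()) , λ { e → Fin.punchInᵢ≢i v Fin.zero (same e) }) ◅ ε
      where
      same : ∀ {u v} → Edge (u , original) (v , first) → v ≡ u
      same vv′ = refl
    toLeaf (v , first)    = v , ε
    toLeaf (v , second)   = v , ((λ ()) , λ { (v″v′ v∈) → ∉⊥ v∈ }) ◅ ε

    leaves : ∀ u v → Star Apart (u , first) (v , first)
    leaves u v with u Fin.≟ v
    ... | yes refl = ε
    ... | no  u≢v  = ((λ eq → u≢v (cong proj₁ eq)) , λ ()) ◅ ε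

  corona-connected : Connected corona
  corona-connected = connected-by Edge (Adj corona) from-edge λ x y →
    toCentre x ◅◅ centres (proj₁ x) (proj₁ y) ◅◅ Star.reverse edge-sym (toCentre y)

  complement-connected : Connected (complement corona)
  complement-connected = connected-by Apart (Adj (complement corona)) from-apart λ x y →
    let u , xu = toLeaf x
        v , yv = toLeaf y
    in  xu ◅◅ leaves u v ◅◅ Star.reverse apart-sym yv

  corona∈𝒯 : 𝒯 corona
  corona∈𝒯 = record
    { H         = K
    ; connected = complete-connected
    ; E         = ⊥
    ; vertices  = labelling
    ; edges     = λ u v → mk⇔ (λ e → e) (λ e → e)
    }
    where
    complete-connected : Connected K
    complete-connected u v with u Fin.≟ v
    ... | yes refl = ε
    ... | no  u≢v  = u≢v ◅ ε

  -- Neither of the leaves v′ and v″ is observed before the other.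
  leaves-unobserved : ∀ {S v} → (∀ {u} → S u → proj₁ (to u) ≢ v) →
                      ∀ {w} → Observed corona S w → to w ≢ (v , first) × to w ≢ (v , second)
  leaves-unobserved {S} {v} avoid {w} obs = unobserved′ {w} obs , unobserved″ {w} obs
    where
    centre′ : ∀ {x y} → Edge x y → y ≡ (v , first) → x ≡ (v , original)
    centre′ vv′       refl = refl
    centre′ (v″v′ v∈) refl = contradiction v∈ ∉⊥

    centre″ : ∀ {x y} → Edge x y → y ≡ (v , second) → x ≡ (v , original)
    centre″ vv″       refl = refl
    centre″ (v′v″ v∈) refl = contradiction v∈ ∉⊥

    other-leaf : ∀ {u x} → to u ≡ (v , original) → Edge (v , original) x → Adj corona u (from x)
    other-leaf {u} {x} eq = subst₂ Edge (sym eq) (sym (strictlyInverseˡ x))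

    unobserved′ : ∀ {w} → Observed corona S w → to w ≢ (v , first)
    unobserved″ : ∀ {w} → Observed corona S w → to w ≢ (v , second)

    unobserved′ (near s (inj₁ refl)) eq = avoid s (cong proj₁ eq)
    unobserved′ (near s (inj₂ e))    eq = avoid s (cong proj₁ (centre′ e eq))
    unobserved′ (force {u} _ e rest) eq = unobserved″ {from (v , second)}
      (rest (other-leaf {u} (centre′ e eq) vv″)
        (λ u≡w → case trans (sym (strictlyInverseˡ (v , second))) (trans (cong to u≡w) eq) of λ ()))
      (strictlyInverseˡ (v , second))

    unobserved″ (near s (inj₁ refl)) eq = avoid s (cong proj₁ eq)
    unobserved″ (near s (inj₂ e))    eq = avoid s (cong proj₁ (centre″ e eq))
    unobserved″ (force {u} _ e rest) eq = unobserved′ {from (v , first)}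
      (rest (other-leaf {u} (centre″ e eq) vv′)
        (λ u≡w → case trans (sym (strictlyInverseˡ (v , first))) (trans (cong to u≡w) eq) of λ ()))
      (strictlyInverseˡ (v , first))

  -- Every vertex of `K` has a centre at itself or at one of its two leaves, and these triples are
  -- disjoint.
  corona-bound : IsγP corona k → 2 + m ≤ k
  corona-bound {k} ((c , obs) , _) = Fin.injective⇒≤ {f = proj₁ ∘ hit} λ {u} {v} eq →
    trans (sym (proj₂ (hit u))) (trans (cong (proj₁ ∘ to ∘ c) eq) (proj₂ (hit v)))
    where
    hit : ∀ v → ∃[ i ] proj₁ (to (c i)) ≡ v
    hit v with Fin.any? (λ i → proj₁ (to (c i)) Fin.≟ v)
    ... | yes found = found
    ... | no  none  = contradiction (strictlyInverseˡ (v , first))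
      (proj₁ (leaves-unobserved {Range c} {v} (λ { (i , refl) eq → none (i , eq) }) {from (v , first)} (obs (from (v , first)))))

  -- The corona contributes n/3 and its complement at least 1, so the general upper bound leaves no
  -- slack.
  attained : (2 + m) * 3 ∉ exceptionalOrders →
             γP corona + γP (complement corona) ≡ ⌈ (2 + m) * 3 /3⌉ + 1
  attained n∉ = squeeze {γP corona} {γP (complement corona)}
    (sum-bound _ corona corona-connected complement-connected n∉)
    (corona-bound {γP corona} (γP-isγP corona))
    (isγP⇒1≤ {G = complement corona} (γP-isγP (complement corona)))
    where
    squeeze : ∀ {a b} → a + b ≤ ⌈ (2 + m) * 3 /3⌉ + 1 → 2 + m ≤ a → 1 ≤ b →
              a + b ≡ ⌈ (2 + m) * 3 /3⌉ + 1
    squeeze upper m≤a 1≤b = ℕ.≤-antisym upper (ℕ.+-mono-≤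
      (ℕ.≤-trans (Equivalence.from (⌈n/3⌉≤k⇔n≤k*3 ((2 + m) * 3) (2 + m)) ℕ.≤-refl) m≤a) 1≤b)

    isγP⇒1≤ : ∀ {n k} {G : Graph n} → IsγP G k → 1 ≤ k
    isγP⇒1≤ γ with isγP⇒positive γ
    ... | _ , refl = s≤s z≤n

exceptional≤24 : ∀ {n} → n ∈ exceptionalOrders → n ≤ 24
exceptional≤24 = All.lookup (from-yes (All.all? (ℕ._≤? 24) exceptionalOrders))

coronas : ∀ m → (2 + m) * 3 ∉ exceptionalOrders →
          Σ[ G ∈ Graph ((2 + m) * 3) ]
          𝒯 G × Connected G × Connected (complement G) ×
          γP G + γP (complement G) ≡ ⌈ (2 + m) * 3 /3⌉ + 1
coronas m n∉ = corona , corona∈𝒯 , corona-connected , complement-connected , attained n∉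
  where open Corona m

-- The summand 7 makes the order at least 27, beyond 24, the largest exceptional order.
arbitrarily-large : ∀ M → ∃[ m ] M ≤ (2 + m) * 3 × 6 ≤ (2 + m) * 3 × (2 + m) * 3 ∉ exceptionalOrders
arbitrarily-large M = 7 + M
  , ℕ.≤-trans (ℕ.m≤n+m M 9) (ℕ.m≤m*n (9 + M) 3)
  , ℕ.≤-trans (ℕ.m≤m+n 6 19) 25≤n
  , λ n∈ → ℕ.<⇒≱ 25≤n (exceptional≤24 n∈)
  where
  25≤n : 25 ≤ (9 + M) * 3
  25≤n = ℕ.≤-trans (ℕ.m≤m+n 25 2) (ℕ.*-monoˡ-≤ 3 (ℕ.m≤m+n 9 M))

theorem3p4 : (∀ (n : ℕ) (G : Graph n) →
    Connected G → Connected (complement G) →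
    n ∉ exceptionalOrders →
    γP G + γP (complement G) ≤ ⌈ n /3⌉ + 1)
    ×
    (∀ (M : ℕ) →
    ∃[ n ] M ≤ n × 6 ≤ n × n ∉ exceptionalOrders ×
    (Σ[ G ∈ Graph n ]
    𝒯 G × Connected G × Connected (complement G) ×
    γP G + γP (complement G) ≡ ⌈ n /3⌉ + 1))
theorem3p4 = sum-bound , λ M →
  let m , M≤n , 6≤n , n∉ = arbitrarily-large M
  in  (2 + m) * 3 , M≤n , 6≤n , n∉ , coronas m n∉
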